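{- Let $\vec G$ be a finite directed multigraph without self-loops with $n$ vertices and $m$ edges, with positive real edge Values and edges listed in chronological order. If Maxflow paths are computed by the max-priority-queue (binary max-heap) widest-path procedure and cycle detection is done by depth-first search, then the Weighted Cycle Deletion procedure (described in the context) runs in time $O\big((m+n)\cdot m^2\cdot \log n\big)$.
   Context: A Maxflow path from $x$ to $y$ in a graph $H$ is a directed path from $x$ to $y$ whose minimum edge Value is maximum among all directed paths from $x$ to $y$ in $H$. It is computed as follows: initialize $\mathrm{dist}[x]=+\infty$, $\mathrm{dist}[w]=-\infty$ otherwise; repeatedly extract from a max-heap a vertex $\mathrm{ver}$ of largest $\mathrm{dist}$, and for each out-neighbor $w$ set $\mathrm{dist}[w]=\max(\mathrm{dist}[w],\min(\mathrm{dist}[\mathrm{ver}],\text{largest Value of an edge from }\mathrm{ver}\text{ to }w))$, recording the corresponding parent edge when $\mathrm{dist}[w]$ increases; then recover the path from parent pointers. The flow value $\phi(C)$ of a directed cycle $C$ is the maximum minus the minimum edge Value on $C$. DELETE\_CYCLE$(G',e)$, with $e$ directed from $u$ to $v$: set $S=\emptyset$, $H=G'$; while $H$ contains a directed path from $v$ to $u$, compute a Maxflow path $P$ from $v$ to $u$ in $H$, add $P$ to $S$, and delete from $H$ every edge whose Value is at least the maximum edge Value of $P$. Then choose $P_{\min}\in S$ minimizing $\phi(P\cup\{e\})$, let $C=P_{\min}\cup\{e\}$ and $c$ the minimum edge Value on $C$; subtract $c$ from every edge Value of $C$ in $G'$, remove edges whose Value becomes $0$, and return $G'$. Weighted Cycle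 Deletion: start with empty $G'$; for $i=1,\dots,m$: insert $e_i$ into $G'$; while $G'$ contains a directed cycle, replace $G'$ by DELETE\_CYCLE$(G',e_i)$. Output $G'$. -}

module Defs where

open import Algebra.Structures using (IsAbelianGroup)
open import Data.Bool.Base using (Bool; true; false; if_then_else_)
open import Data.Fin.Base using (Fin)
import Data.Fin.Properties as Fin
open import Data.List.Base using (List; []; _∷_; allFin)
open import Data.List.NonEmpty.Base using (List⁺; _∷_; _∷⁺_; toList)
open import Data.Maybe.Base using (Maybe; just; nothing)
open import Data.Nat.Base using (ℕ; zero; suc; ⌊_/2⌋) renaming (_+_ to _+ℕ_)
import Data.Nat.Properties as ℕ
open import Data.Product.Base using (_×_; _,_)
open import Data.Sum.Base using (_⊎_; inj₁; inj₂)
open import Data.Unit.Base using (⊤; tt)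
open import Level using (0ℓ)
open import Relation.Binary.Core using (Rel)
open import Relation.Binary.Definitions using (DecidableEquality)
open import Relation.Binary.PropositionalEquality.Core using (_≢_)
open import Relation.Binary.Structures using (IsDecTotalOrder)
open import Relation.Nullary.Decidable.Core using (Dec; does)
open import Relation.Nullary.Construct.Add.Extrema using (_±; ⊥±; ⊤±; [_])
import Relation.Binary.Construct.Add.Extrema.NonStrict as AddExtrema
import Relation.Binary.Construct.NonStrictToStrict as ToStrict

-- The procedure only adds, subtracts and compares Values.  They are taken from
-- an arbitrary totally ordered abelian group whose comparisons are decidable
-- (as in the real-RAM model); (ℝ, +, ≤) is the intended example.
record OrderedAbelianGroup : Set₁ where
  infixl 6 _+_ _-_
  infix  4 _≈_ _≤_ _<_
  field
    Carrier         : Set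
    _≈_             : Rel Carrier 0ℓ
    _≤_             : Rel Carrier 0ℓ
    _+_             : Carrier → Carrier → Carrier
    0#              : Carrier
    -_              : Carrier → Carrier
    isAbelianGroup  : IsAbelianGroup _≈_ _+_ 0# -_
    isDecTotalOrder : IsDecTotalOrder _≈_ _≤_
    +-monoˡ-≤       : ∀ z {x y} → x ≤ y → (x + z) ≤ (y + z)

  open IsDecTotalOrder isDecTotalOrder public using (_≟_; _≤?_)

  _<_ : Rel Carrier 0ℓ
  _<_ = ToStrict._<_ _≈_ _≤_

  _-_ : Carrier → Carrier → Carrier
  x - y = x + (- y)

-- Parallel edges are allowed; the order of Fin m is the chronological order.
record WeightedMultidigraph (V : OrderedAbelianGroup) (n m : ℕ) : Set where
  open OrderedAbelianGroup V
  field
    src tgt  : Fin m → Fin n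
    loopless : ∀ e → src e ≢ tgt e
    value    : Fin m → Carrier
    positive : ∀ e → 0# < value e

module WeightedCycleDeletion
  (V : OrderedAbelianGroup) {n m : ℕ} (G : WeightedMultidigraph V n m) where

  open OrderedAbelianGroup V public using (_≟_; _≤?_; _-_; 0#) renaming (Carrier to Value)
  open WeightedMultidigraph G public
  open AddExtrema (OrderedAbelianGroup._≤_ V) public using (_≤±_; ≤±-dec)

  Vertex Edge : Set
  Vertex = Fin n
  Edge   = Fin m

  -- ⊥± and ⊤± are -∞ and +∞.
  Value± : Set
  Value± = Value ±

  _≤±?_ : (x y : Value±) → Dec (x ≤± y)
  _≤±?_ = ≤±-dec _≤?_

  min± : Value± → Value± → Value±
  min± x y = if does (x ≤±? y) then x else y

  data Colour : Set where
    white grey black : Colour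

  -- adj    : edges inserted so far, by source; a linked list which may also
  --          contain edges that have been removed from the graph meanwhile
  -- inG    : membership in G';  inH : membership in H
  -- val    : current Value (shared by G' and H)
  -- best   : an edge of largest Value from the scanned vertex to the index
  -- heap   : binary max-heap of vertices with keys dist, stored at the positions 1 , … , size
  -- pos    : position in the heap, 0 for a vertex outside it
  data Array : Set where
    adj inG inH val colour dist parent best heap pos size : Array

  Index : Array → Set
  Index adj    = Vertex
  Index inG    = Edge
  Index inH    = Edge
  Index val    = Edge
  Index colour = Vertex
  Index dist   = Vertex
  Index parent = Vertex
  Index best   = Vertex
  Index heap   = ℕ
  Index pos    = Vertex
  Index size   = ⊤

  Cell : Array → Set
  Cell adj    = List Edge
  Cell inG    = Bool
  Cell inH    = Bool
  Cell val    = Value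
  Cell colour = Colour
  Cell dist   = Value±
  Cell parent = Edge
  Cell best   = Edge
  Cell heap   = Vertex
  Cell pos    = ℕ
  Cell size   = ℕ

  record Store : Set where
    field
      adjₛ    : Index adj    → Cell adj
      inGₛ    : Index inG    → Cell inG
      inHₛ    : Index inH    → Cell inH
      valₛ    : Index val    → Cell val
      colourₛ : Index colour → Cell colour
      distₛ   : Index dist   → Cell dist
      parentₛ : Index parent → Cell parent
      bestₛ   : Index best   → Cell best
      heapₛ   : Index heap   → Cell heap
      posₛ    : Index pos    → Cell pos
      sizeₛ   : Index size   → Cell size

  lookup : Store → (a : Array) → Index a → Cell a
  lookup σ adj    = Store.adjₛ σ
  lookup σ inG    = Store.inGₛ σ
  lookup σ inH    = Store.inHₛ σ
  lookup σ val    = Store.valₛ σ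
  lookup σ colour = Store.colourₛ σ
  lookup σ dist   = Store.distₛ σ
  lookup σ parent = Store.parentₛ σ
  lookup σ best   = Store.bestₛ σ
  lookup σ heap   = Store.heapₛ σ
  lookup σ pos    = Store.posₛ σ
  lookup σ size   = Store.sizeₛ σ

  override : {I A : Set} → DecidableEquality I → (I → A) → I → A → (I → A)
  override _≡?_ f i x j = if does (i ≡? j) then x else f j

  update : Store → (a : Array) → Index a → Cell a → Store
  update σ adj    i x = record σ { adjₛ    = override Fin._≟_ (Store.adjₛ σ) i x }
  update σ inG    i x = record σ { inGₛ    = override Fin._≟_ (Store.inGₛ σ) i x }
  update σ inH    i x = record σ { inHₛ    = override Fin._≟_ (Store.inHₛ σ) i x }
  update σ val    i x = record σ { valₛ    = override Fin._≟_ (Store.valₛ σ) i x }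
  update σ colour i x = record σ { colourₛ = override Fin._≟_ (Store.colourₛ σ) i x }
  update σ dist   i x = record σ { distₛ   = override Fin._≟_ (Store.distₛ σ) i x }
  update σ parent i x = record σ { parentₛ = override Fin._≟_ (Store.parentₛ σ) i x }
  update σ best   i x = record σ { bestₛ   = override Fin._≟_ (Store.bestₛ σ) i x }
  update σ heap   i x = record σ { heapₛ   = override ℕ._≟_ (Store.heapₛ σ) i x }
  update σ pos    i x = record σ { posₛ    = override Fin._≟_ (Store.posₛ σ) i x }
  update σ size   i x = record σ { sizeₛ   = λ _ → x }

  infixl 1 _>>=_ _>>_

  -- In `loop body s`, a result inj₁ s′ of the body continues with s′ and a
  -- result inj₂ x leaves the loop with x.
  data Prog : Set → Set₁ where
    return : ∀ {A} → A → Prog A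
    _>>=_  : ∀ {A B} → Prog A → (A → Prog B) → Prog B
    read   : (a : Array) → Index a → Prog (Cell a)
    write  : (a : Array) → Index a → Cell a → Prog ⊤
    loop   : ∀ {A S : Set} → (S → Prog (S ⊎ A)) → S → Prog A

  _>>_ : ∀ {A B} → Prog A → Prog B → Prog B
  p >> q = p >>= λ _ → q

  infix 4 ⟨_,_⟩⇓⟨_,_⟩_

  -- ⟨ p , σ ⟩⇓⟨ x , σ′ ⟩ t : started in store σ, the program p halts with
  -- result x in store σ′ after t steps.  Every executed return, read and write
  -- is a step.  The pure code executed between two steps of the programs below
  -- is always a bounded number of tests and operations on indices, Values and
  -- pointers to linked lists (including look-ups in the input G), so that
  -- steps measure time up to a constant factor.
  data ⟨_,_⟩⇓⟨_,_⟩_ : ∀ {A} → Prog A → Store → A → Store → ℕ → Set₁ where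
    ⇓return : ∀ {A} {x : A} {σ} → ⟨ return x , σ ⟩⇓⟨ x , σ ⟩ 1
    ⇓read   : ∀ {a i σ} → ⟨ read a i , σ ⟩⇓⟨ lookup σ a i , σ ⟩ 1
    ⇓write  : ∀ {a i x σ} → ⟨ write a i x , σ ⟩⇓⟨ tt , update σ a i x ⟩ 1
    ⇓bind   : ∀ {A B} {p : Prog A} {k : A → Prog B} {σ x σ₁ t₁ y σ₂ t₂} →
              ⟨ p , σ ⟩⇓⟨ x , σ₁ ⟩ t₁ → ⟨ k x , σ₁ ⟩⇓⟨ y , σ₂ ⟩ t₂ →
              ⟨ p >>= k , σ ⟩⇓⟨ y , σ₂ ⟩ (t₁ +ℕ t₂)
    ⇓exit   : ∀ {A S : Set} {body : S → Prog (S ⊎ A)} {s σ x σ₁ t} →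
              ⟨ body s , σ ⟩⇓⟨ inj₂ x , σ₁ ⟩ t →
              ⟨ loop body s , σ ⟩⇓⟨ x , σ₁ ⟩ t
    ⇓again  : ∀ {A S : Set} {body : S → Prog (S ⊎ A)} {s σ s′ σ₁ t₁ x σ₂ t₂} →
              ⟨ body s , σ ⟩⇓⟨ inj₁ s′ , σ₁ ⟩ t₁ → ⟨ loop body s′ , σ₁ ⟩⇓⟨ x , σ₂ ⟩ t₂ →
              ⟨ loop body s , σ ⟩⇓⟨ x , σ₂ ⟩ (t₁ +ℕ t₂)

  skip : Prog ⊤
  skip = return tt

  forEach : {A : Set} → List A → (A → Prog ⊤) → Prog ⊤
  forEach []       body = skip
  forEach (x ∷ xs) body = body x >> forEach xs body

  -- Used as `forEach vertices` and `forEach edges`, i.e. counting loops.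
  vertices : List Vertex
  vertices = allFin n

  edges : List Edge
  edges = allFin m

  place : ℕ → Vertex → Prog ⊤
  place i v = write heap i v >> write pos v i

  siftUpStep : ℕ → Prog (ℕ ⊎ ⊤)
  siftUpStep i =
    if does (i ℕ.≤? 1) then return (inj₂ tt) else do
      let j = ⌊ i /2⌋
      v  ← read heap i
      w  ← read heap j
      dv ← read dist v
      dw ← read dist w
      if does (dv ≤±? dw) then return (inj₂ tt) else do
        place i w
        place j v
        return (inj₁ j)

  siftUp : ℕ → Prog ⊤
  siftUp = loop siftUpStep

  largerChild : ℕ → ℕ → Prog ℕ
  largerChild k i = do
    let l = i +ℕ i
        r = suc l
    if does (r ℕ.≤? k)
      then (do
        v  ← read heap l
        w  ← read heap r
        dv ← read dist v
        dw ← read dist w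
        return (if does (dw ≤±? dv) then l else r))
      else return l

  siftDownStep : ℕ → Prog (ℕ ⊎ ⊤)
  siftDownStep i = do
    k ← read size tt
    if does ((i +ℕ i) ℕ.≤? k)
      then (do
        j  ← largerChild k i
        v  ← read heap i
        w  ← read heap j
        dv ← read dist v
        dw ← read dist w
        if does (dw ≤±? dv) then return (inj₂ tt) else do
          place i w
          place j v
          return (inj₁ j))
      else return (inj₂ tt)

  siftDown : ℕ → Prog ⊤
  siftDown = loop siftDownStep

  insert : Vertex → Prog ⊤
  insert v = do
    k ← read size tt
    write size tt (suc k)
    place (suc k) v
    siftUp (suc k)

  extractMaxFrom : ℕ → Prog (Maybe Vertex)
  extractMaxFrom zero    = return nothing
  extractMaxFrom (suc k) = do
    v ← read heap 1
    w ← read heap (suc k)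
    write size tt k
    place 1 w
    write pos v 0
    siftDown 1
    return (just v)

  extractMax : Prog (Maybe Vertex)
  extractMax = read size tt >>= extractMaxFrom

  ifInH : Edge → Prog ⊤ → Prog ⊤
  ifInH e p = do
    b ← read inH e
    if b then p else skip

  increaseKey : ℕ → Prog ⊤
  increaseKey zero      = skip
  increaseKey i@(suc _) = siftUp i

  -- To be run after dist[w] has been raised; the second argument is the old
  -- dist[w].  The heap never holds vertices with dist -∞, since scanning such
  -- a vertex would change nothing.
  requeue : Vertex → Value± → Prog ⊤
  requeue w ⊥± = insert w
  requeue w _  = read pos w >>= increaseKey

  -- dist[tgt e] := max(dist[tgt e], min(dist[ver], Value of e))
  relax : Vertex → Edge → Prog ⊤
  relax ver e = do
    let w = tgt e
    dver ← read dist ver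
    x    ← read val e
    dw   ← read dist w
    let d = min± dver [ x ]
    if does (d ≤±? dw) then skip else do
      write dist w d
      write parent w e
      requeue w dw

  improveBest : Edge → Prog ⊤
  improveBest e = do
    f ← read best (tgt e)
    x ← read val f
    y ← read val e
    if does (y ≤? x) then skip else write best (tgt e) e

  scan : Vertex → Prog ⊤
  scan ver = do
    es ← read adj ver
    forEach es λ e → ifInH e (write best (tgt e) e)
    forEach es λ e → ifInH e (improveBest e)
    forEach es λ e → ifInH e (read best (tgt e) >>= relax ver)

  afterExtract : Maybe Vertex → Prog (⊤ ⊎ ⊤)
  afterExtract nothing    = return (inj₂ tt)
  afterExtract (just ver) = scan ver >> return (inj₁ tt)

  computeDist : Vertex → Prog ⊤
  computeDist x = do
    forEach vertices λ v → write dist v ⊥± >> write pos v 0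
    write size tt 0
    write dist x ⊤±
    insert x
    loop (λ _ → extractMax >>= afterExtract) tt

  -- The edges of a path from x to y ≢ x, in the order of traversal.
  Path : Set
  Path = List⁺ Edge

  extendBack : Vertex → Path → Prog (Path ⊎ Path)
  extendBack x P@(e ∷ _) =
    if does (src e Fin.≟ x) then return (inj₂ P) else do
      f ← read parent (src e)
      return (inj₁ (f ∷⁺ P))

  recoverPath : Vertex → Vertex → Prog Path
  recoverPath x y = do
    e ← read parent y
    loop (extendBack x) (e ∷ [])

  pathIfReached : Vertex → Vertex → Value± → Prog (Maybe Path)
  pathIfReached x y ⊥± = return nothing
  pathIfReached x y _  = do
    P ← recoverPath x y
    return (just P)

  -- The result is nothing if H contains no directed path from x to y.
  maxflowPath : Vertex → Vertex → Prog (Maybe Path)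
  maxflowPath x y = do
    computeDist x
    d ← read dist y
    pathIfReached x y d

  maxFrom minFrom : Value → List Edge → Prog Value
  maxFrom x []       = return x
  maxFrom x (e ∷ es) = do
    y ← read val e
    maxFrom (if does (x ≤? y) then y else x) es
  minFrom x []       = return x
  minFrom x (e ∷ es) = do
    y ← read val e
    minFrom (if does (x ≤? y) then x else y) es

  maxValue minValue flowValue : List⁺ Edge → Prog Value
  maxValue (e ∷ es) = read val e >>= λ x → maxFrom x es
  minValue (e ∷ es) = read val e >>= λ x → minFrom x es
  flowValue C = do
    x ← maxValue C
    y ← minValue C
    return (x - y)

  removeFromH : Value → Prog ⊤
  removeFromH x = forEach edges λ f → do
    y ← read val f
    if does (x ≤? y) then write inH f false else skip

  afterPath : List Path → Maybe Path → Prog (List Path ⊎ List Path)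
  afterPath S nothing  = return (inj₂ S)
  afterPath S (just P) = do
    x ← maxValue P
    removeFromH x
    return (inj₁ (P ∷ S))

  collectPaths : Vertex → Vertex → Prog (List Path)
  collectPaths v u = loop (λ S → maxflowPath v u >>= afterPath S) []

  -- `minimizer e P x Ps` : a path among P ∷ Ps with least ϕ(P ∪ {e}), where
  -- x is ϕ(P ∪ {e}).
  minimizer : Edge → Path → Value → List Path → Prog Path
  minimizer e P x []       = return P
  minimizer e P x (Q ∷ Qs) = do
    y ← flowValue (e ∷⁺ Q)
    if does (x ≤? y) then minimizer e P x Qs else minimizer e Q y Qs

  subtractAlong : List⁺ Edge → Prog ⊤
  subtractAlong C = do
    c ← minValue C
    forEach (toList C) λ f → do
      x ← read val f
      let y = x - c
      write val f y
      if does (y ≟ 0#) then write inG f false else skip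

  -- S is never empty when G' contains a directed cycle through e.
  cancelBest : Edge → List Path → Prog ⊤
  cancelBest e []       = skip
  cancelBest e (P ∷ Ps) = do
    x    ← flowValue (e ∷⁺ P)
    Pmin ← minimizer e P x Ps
    subtractAlong (e ∷⁺ Pmin)

  deleteCycle : Edge → Prog ⊤
  deleteCycle e = do
    forEach edges λ f → read inG f >>= write inH f
    S ← collectPaths (tgt e) (src e)
    cancelBest e S

  -- The stack of grey vertices, each with its out-edges still to be explored.
  Stack : Set
  Stack = List (Vertex × List Edge)

  discover : Vertex → Stack → Prog (Stack ⊎ Bool)
  discover w st = do
    write colour w grey
    es ← read adj w
    return (inj₁ ((w , es) ∷ st))

  visit : Vertex → Stack → Colour → Prog (Stack ⊎ Bool)
  visit w st white = discover w st
  visit w st grey  = return (inj₂ true)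
  visit w st black = return (inj₁ st)

  dfsStep : Stack → Prog (Stack ⊎ Bool)
  dfsStep []                   = return (inj₂ false)
  dfsStep ((v , []) ∷ st)      = do
    write colour v black
    return (inj₁ st)
  dfsStep ((v , e ∷ es) ∷ st) = do
    let st′ = (v , es) ∷ st
    b ← read inG e
    if b then read colour (tgt e) >>= visit (tgt e) st′ else return (inj₁ st′)

  dfs : Vertex → Prog Bool
  dfs v = do
    write colour v grey
    es ← read adj v
    loop dfsStep ((v , es) ∷ [])

  dfsIfWhite : Vertex → Colour → Prog Bool
  dfsIfWhite v white = dfs v
  dfsIfWhite v _     = return false

  dfsFromAll : List Vertex → Prog Bool
  dfsFromAll []       = return false
  dfsFromAll (v ∷ vs) = do
    c ← read colour v
    b ← dfsIfWhite v c
    if b then return true else dfsFromAll vs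

  hasCycle : Prog Bool
  hasCycle = do
    forEach vertices λ v → write colour v white
    dfsFromAll vertices

  insertEdge : Edge → Prog ⊤
  insertEdge e = do
    es ← read adj (src e)
    write adj (src e) (e ∷ es)
    write val e (value e)
    write inG e true

  deleteIfCycle : Edge → Bool → Prog (⊤ ⊎ ⊤)
  deleteIfCycle e false = return (inj₂ tt)
  deleteIfCycle e true  = deleteCycle e >> return (inj₁ tt)

  -- The output G' is left in the arrays inG and val.
  weightedCycleDeletion : Prog ⊤
  weightedCycleDeletion = do
    forEach vertices λ v → write adj v []
    forEach edges λ e → write inG e false
    forEach edges λ e → do
      insertEdge e
      loop (λ _ → hasCycle >>= deleteIfCycle e) tt

{-# OPTIONS --safe #-}
-- Every DELETE_CYCLE takes an edge out of G': the Value c subtracted along C is attained on C.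
-- Every Maxflow path found takes an edge out of H, namely the one of largest Value on the path.
-- So there are at most m calls of DELETE_CYCLE in all, each with at most m + 1 widest-path
-- computations, and it remains to see that one such computation takes O((m + n) log n) steps and
-- one cycle detection O(m + n) steps.
--
-- Little of the correctness of the procedures is needed for this.  No heap order is used,
-- only that the arrays heap and pos stay inverse to each other: then each vertex is extracted and
-- scanned at most once.  The parent edges always form a tree, since dist never decreases towards the
-- root and a vertex whose dist is raised therefore is not an ancestor of the vertex scanned.
-- DELETE_CYCLE makes progress because G' without the new edge e is acyclic (depth-first search
-- answers correctly), whence any cycle of G' gives a path from the head of e to its tail, so that
-- the first search finds a path.
module Submission where

open import Defs
open import Algebra.Structures using (IsAbelianGroup)
open import Data.Bool.Base using (Bool; true; false; if_then_else_)
import Data.Bool.Properties as Bool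
open import Data.Empty using (⊥; ⊥-elim)
open import Data.Fin.Base using (Fin; zero; suc; toℕ)
import Data.Fin.Properties as Fin
open import Data.List.Base using (List; []; _∷_; length; allFin)
open import Data.List.Membership.Propositional using (_∈_)
open import Data.List.Membership.Propositional.Properties using (∈-allFin)
open import Data.List.NonEmpty.Base using (List⁺; _∷_; _∷⁺_; toList)
open import Data.List.Properties using (length-tabulate)
open import Data.List.Relation.Unary.All as All using (All; []; _∷_)
open import Data.List.Relation.Unary.Any using (Any; here; there)
open import Data.Maybe.Base using (Maybe; just; nothing)
open import Data.Nat.Base
  using (ℕ; zero; suc; pred; _+_; _*_; _∸_; _^_; _≤_; _<_; z≤n; s≤s; ⌊_/2⌋; ⌈_/2⌉; >-nonZero)
open import Data.Nat.Induction using (<-wellFounded)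
open import Data.Nat.Logarithm using (⌊log₂_⌋; ⌊log₂⌋-mono-≤; ⌊log₂⌊n/2⌋⌋≡⌊log₂n⌋∸1)
import Data.Nat.Properties as ℕ
open import Data.Nat.Tactic.RingSolver using (solve-∀)
open import Data.Product.Base using (∃; ∃₂; _×_; _,_; -,_; proj₁; proj₂)
open import Data.Sum.Base using (_⊎_; inj₁; inj₂; [_,_]′)
open import Data.Unit.Base using (⊤; tt)
open import Function.Base using (_∘_; id; case_of_)
open import Induction.WellFounded using (Acc; acc)
import Relation.Binary.Construct.Add.Extrema.NonStrict as AddExtrema
open import Relation.Binary.Construct.Closure.ReflexiveTransitive as Star using (Star; ε; _◅_; _◅◅_)
open import Relation.Binary.Definitions using (DecidableEquality)
open import Relation.Binary.PropositionalEquality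
  using (_≡_; _≢_; refl; sym; trans; cong; cong₂; subst; ≢-sym)
open import Relation.Binary.Structures using (IsDecTotalOrder)
open import Relation.Nullary using (Dec; yes; no; does; ¬_; contradiction)
open import Relation.Nullary.Construct.Add.Extrema using (⊥±; ⊤±; [_])

-- The obstacle is amortisation: one insertion may trigger many calls of DELETE_CYCLE, and only
-- their number over the whole run is at most `m`. Budgets are therefore threaded through the
-- programs, and what is left over is handed on. Every edge of G' carries `roundCost`, the price of
-- one detection and one deletion; an insertion deposits it and the removal of an edge releases it.
-- The linear cost of depth-first search and the single scan per vertex in the widest-path search
-- are obtained in the same way, the carriers being the white vertices and the vertices not yet
-- extracted. Edges removed from G' stay in the adjacency lists. Scanning remains cheap because
-- every edge is entered once, so that all lists together have length at most `m`.

-- Finite sums and weights of decidable subsets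

total : ∀ {n} → (Fin n → ℕ) → ℕ
total {zero}  f = 0
total {suc n} f = f zero + total (f ∘ suc)

total-mono : ∀ {n} {f g : Fin n → ℕ} → (∀ i → f i ≤ g i) → total f ≤ total g
total-mono {zero}  f≤g = z≤n
total-mono {suc n} f≤g = ℕ.+-mono-≤ (f≤g zero) (total-mono (f≤g ∘ suc))

total-zero : ∀ {n} {f : Fin n → ℕ} → (∀ i → f i ≡ 0) → total f ≡ 0
total-zero {zero}  f≡0 = refl
total-zero {suc n} f≡0 = cong₂ _+_ (f≡0 zero) (total-zero (f≡0 ∘ suc))

total-affine : ∀ {n} a c (f : Fin n → ℕ) → total (λ i → a + f i * c) ≡ n * a + total f * c
total-affine {zero}  a c f = refl
total-affine {suc n} a c f =
  trans (cong (a + f zero * c +_) (total-affine a c (f ∘ suc)))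
    (rearrange a c (f zero) (n * a) (total (f ∘ suc)))
  where
  rearrange : ∀ a c x y z → (a + x * c) + (y + z * c) ≡ (a + y) + (x + z) * c
  rearrange = solve-∀

-- The offsets `c` and `d` replace a signed difference at the index `i`, so that decreases
-- (`weight-drop`) and increases (`count-add`, `insert-total`) are both instances.
total-change : ∀ {n} {f g : Fin n → ℕ} {c d} i → (∀ j → i ≢ j → f j ≤ g j) → c + f i ≤ d + g i →
               c + total f ≤ d + total g
total-change {suc n} {f} {g} {c} {d} zero le le₀ = begin
  c + (f zero + total (f ∘ suc))  ≡⟨ ℕ.+-assoc c _ _ ⟨
  c + f zero + total (f ∘ suc)    ≤⟨ ℕ.+-mono-≤ le₀ (total-mono λ j → le (suc j) λ ()) ⟩
  d + g zero + total (g ∘ suc)    ≡⟨ ℕ.+-assoc d _ _ ⟩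
  d + (g zero + total (g ∘ suc))  ∎
  where open ℕ.≤-Reasoning
total-change {suc n} {f} {g} {c} {d} (suc i) le le₀ = begin
  c + (f zero + total (f ∘ suc))  ≡⟨ swap c (f zero) _ ⟩
  f zero + (c + total (f ∘ suc))  ≤⟨ ℕ.+-mono-≤ (le zero λ ())
                                       (total-change i (λ j i≢j → le (suc j) λ { refl → i≢j refl }) le₀) ⟩
  g zero + (d + total (g ∘ suc))  ≡⟨ swap (g zero) d _ ⟩
  d + (g zero + total (g ∘ suc))  ∎
  where
  open ℕ.≤-Reasoning
  swap : ∀ x y z → x + (y + z) ≡ y + (x + z)
  swap = solve-∀

-- The potential of the amortised arguments: `b` is the set of items whose cost `w` has not been
-- spent yet.
weight : ∀ {n} → (Fin n → ℕ) → (Fin n → Bool) → ℕ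
weight w b = total (λ i → if b i then w i else 0)

private
  if-mono : ∀ {x} {b b′ : Bool} → (b ≡ true → b′ ≡ true) → (if b then x else 0) ≤ (if b′ then x else 0)
  if-mono {b = false}          imp = z≤n
  if-mono {b = true} {b′ = b′} imp rewrite imp refl = ℕ.≤-refl

weight-drop : ∀ {n} (w : Fin n → ℕ) {b b′ : Fin n → Bool} i → b i ≡ true → b′ i ≡ false →
              (∀ j → b′ j ≡ true → b j ≡ true) → w i + weight w b′ ≤ weight w b
weight-drop w {b} {b′} i bi b′i sub = total-change i (λ j _ → if-mono (sub j)) wi≤
  where
  wi≤ : w i + (if b′ i then w i else 0) ≤ (if b i then w i else 0)
  wi≤ rewrite bi | b′i = ℕ.≤-reflexive (ℕ.+-identityʳ (w i))

weight-mono : ∀ {n} (w : Fin n → ℕ) {b b′ : Fin n → Bool} → (∀ j → b j ≡ true → b′ j ≡ true) →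
              weight w b ≤ weight w b′
weight-mono w sub = total-mono (λ j → if-mono (sub j))

weight≤total : ∀ {n} (w : Fin n → ℕ) b → weight w b ≤ total w
weight≤total w b = total-mono λ i → if-mono {b = b i} {true} λ _ → refl

count : ∀ {n} → (Fin n → Bool) → ℕ
count = weight (λ _ → 1)

count≤n : ∀ {n} (b : Fin n → Bool) → count b ≤ n
count≤n {n} b = ℕ.≤-trans (weight≤total (λ _ → 1) b) (ℕ.≤-reflexive (total-one n))
  where
  total-one : ∀ n → total {n} (λ _ → 1) ≡ n
  total-one zero    = refl
  total-one (suc n) = cong suc (total-one n)

count-positive : ∀ {n} {b : Fin n → Bool} i → b i ≡ true → 1 ≤ count b
count-positive i bi =
  ℕ.≤-trans (ℕ.m≤m+n 1 _) (weight-drop (λ _ → 1) {b′ = λ _ → false} i bi refl λ _ ())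

count-add : ∀ {n} {b b′ : Fin n → Bool} i → (∀ j → i ≢ j → b′ j ≡ true → b j ≡ true) →
            count b′ ≤ suc (count b)
count-add {b = b} {b′} i sub =
  total-change {c = 0} {d = 1} i (λ j i≢j → if-mono (sub j i≢j)) (at-most-one (b′ i))
  where
  at-most-one : ∀ c → (if c then 1 else 0) ≤ 1 + (if b i then 1 else 0)
  at-most-one true  = s≤s z≤n
  at-most-one false = z≤n

-- A program logic with step budgets

module ProgramLogic
  (V : OrderedAbelianGroup) {n m : ℕ} (G : WeightedMultidigraph V n m) where

  open WeightedCycleDeletion V G

  private variable
    A B S : Set
    σ : Store
    k : ℕ

  -- The post-condition also speaks about the steps of the budget k that are
  -- left over, which allows amortised bounds.
  record Runs (p : Prog A) (σ : Store) (k : ℕ) (Q : A → Store → ℕ → Set) : Set₁ where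
    constructor runs
    field
      {result}    : A
      {final}     : Store
      {time rest} : ℕ
      run         : ⟨ p , σ ⟩⇓⟨ result , final ⟩ time
      within      : time + rest ≤ k
      post        : Q result final rest

  private variable
    Q : A → Store → ℕ → Set
    R : B → Store → ℕ → Set

  Runs′ : Prog A → Store → ℕ → (A → Store → Set) → Set₁
  Runs′ p σ c Q = Runs p σ c (λ x σ′ _ → Q x σ′)

  weaken : ∀ {p : Prog A} {k k′} → k ≤ k′ → Runs p σ k Q → Runs p σ k′ Q
  weaken k≤k′ (runs r t q) = runs r (ℕ.≤-trans t k≤k′) q

  consequence : ∀ {p : Prog A} {Q R : A → Store → ℕ → Set} →
                (∀ {x σ′ k′} → Q x σ′ k′ → R x σ′ k′) → Runs p σ k Q → Runs p σ k R
  consequence Q⇒R (runs r t q) = runs r t (Q⇒R q)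

  return-runs : ∀ {x : A} → Q x σ k → Runs (return x) σ (suc k) Q
  return-runs q = runs ⇓return ℕ.≤-refl q

  write-runs : ∀ {a i x} → Q tt (update σ a i x) k → Runs (write a i x) σ (suc k) Q
  write-runs q = runs ⇓write ℕ.≤-refl q

  private
    sequence-time : ∀ t₁ t₂ {r k k′} → t₁ + k′ ≤ k → t₂ + r ≤ k′ → (t₁ + t₂) + r ≤ k
    sequence-time t₁ t₂ {r} le₁ le₂ =
      ℕ.≤-trans (ℕ.≤-reflexive (ℕ.+-assoc t₁ t₂ r)) (ℕ.≤-trans (ℕ.+-monoʳ-≤ t₁ le₂) le₁)

  bind : ∀ {p : Prog A} {f : A → Prog B} → Runs p σ k Q →
         (∀ {x σ′ k′} → Q x σ′ k′ → Runs (f x) σ′ k′ R) → Runs (p >>= f) σ k R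
  bind (runs {time = t₁} r₁ le₁ q) h with runs {time = t₂} r₂ le₂ q₂ ← h q =
    runs (⇓bind r₁ r₂) (sequence-time t₁ t₂ le₁ le₂) q₂

  run-bind : ∀ {p : Prog A} {f : A → Prog B} {x σ′ t} → ⟨ p , σ ⟩⇓⟨ x , σ′ ⟩ t →
             Runs (f x) σ′ k R → Runs (p >>= f) σ (t + k) R
  run-bind {t = t₁} r₁ (runs {time = t₂} r₂ le₂ q₂) =
    runs (⇓bind r₁ r₂) (sequence-time t₁ t₂ ℕ.≤-refl le₂) q₂

  -- In contrast to `bind`, the surplus of the first program is dropped, so that the continuation
  -- has exactly the budget `k` and budgets remain explicit expressions.
  call : ∀ {p : Prog A} {f : A → Prog B} {c} {P : A → Store → Set} → Runs′ p σ c P →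
         (∀ {x σ′} → P x σ′ → Runs (f x) σ′ k R) → Runs (p >>= f) σ (c + k) R
  call {k = k} (runs {time = t} {rest} r le q) h =
    weaken (ℕ.+-monoˡ-≤ k (ℕ.≤-trans (ℕ.m≤m+n t rest) le)) (run-bind r (h q))

  read-bind : ∀ {a i} {f : Cell a → Prog B} →
              Runs (f (lookup σ a i)) σ k R → Runs (read a i >>= f) σ (suc k) R
  read-bind = run-bind ⇓read

  write-bind : ∀ {a i x} {f : ⊤ → Prog B} →
               Runs (f tt) (update σ a i x) k R → Runs (write a i x >>= f) σ (suc k) R
  write-bind = run-bind ⇓write

  place-bind : ∀ {i v} {f : ⊤ → Prog B} →
               Runs (f tt) (update (update σ heap i v) pos v i) k R →
               Runs (place i v >>= f) σ (2 + k) R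
  place-bind = run-bind (⇓bind ⇓write ⇓write)

  if-runs : ∀ {P : Set} (d : Dec P) {p q : Prog A} →
            (P → Runs p σ k Q) → (¬ P → Runs q σ k Q) →
            Runs (if does d then p else q) σ k Q
  if-runs (yes x) t e = t x
  if-runs (no ¬x) t e = e ¬x

  if-bool-runs : ∀ b {p q : Prog A} →
                 (b ≡ true → Runs p σ k Q) → (b ≡ false → Runs q σ k Q) →
                 Runs (if b then p else q) σ k Q
  if-bool-runs true  t e = t refl
  if-bool-runs false t e = e refl

  -- A single unfolding, for loops bounded by a structural induction (on the levels of the heap or
  -- the links of a chain); `loop-runs` serves the loops bounded only by their potential.
  loop-unfold : ∀ {body : S → Prog (S ⊎ A)} {s} → Runs (body s) σ k Q →
                (∀ {s′ σ′ k′} → Q (inj₁ s′) σ′ k′ → Runs (loop body s′) σ′ k′ R) →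
                (∀ {x σ′ k′} → Q (inj₂ x) σ′ k′ → R x σ′ k′) →
                Runs (loop body s) σ k R
  loop-unfold (runs {result = inj₁ s′} {time = t₁} r₁ le₁ q) again exit
    with runs {time = t₂} r₂ le₂ q₂ ← again q = runs (⇓again r₁ r₂) (sequence-time t₁ t₂ le₁ le₂) q₂
  loop-unfold (runs {result = inj₂ x} r le q) again exit = runs (⇓exit r) le (exit q)

  time-positive : ∀ {p : Prog A} {x σ′ t} → ⟨ p , σ ⟩⇓⟨ x , σ′ ⟩ t → 1 ≤ t
  time-positive ⇓return      = ℕ.≤-refl
  time-positive ⇓read        = ℕ.≤-refl
  time-positive ⇓write       = ℕ.≤-refl
  time-positive (⇓bind r _)  = ℕ.≤-trans (time-positive r) (ℕ.m≤m+n _ _)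
  time-positive (⇓exit r)    = time-positive r
  time-positive (⇓again r _) = ℕ.≤-trans (time-positive r) (ℕ.m≤m+n _ _)

  -- The budget itself is the termination measure, as every iteration takes a step.
  loop-runs : ∀ {body : S → Prog (S ⊎ A)} (I : S → Store → ℕ → Set) →
              (∀ {s σ k} → I s σ k →
                 Runs (body s) σ k (λ r σ′ k′ → [ (λ s′ → I s′ σ′ k′) , (λ x → Q x σ′ k′) ]′ r)) →
              ∀ {s σ k} → I s σ k → Runs (loop body s) σ k Q
  loop-runs {S = S} {A = A} {Q = Q} {body = body} I step = λ i → go (<-wellFounded _) i
    where
    go : ∀ {s σ k} → Acc _<_ k → I s σ k → Runs (loop body s) σ k Q
    go (acc smaller) i with step i
    ... | runs {result = inj₂ x} r le q = runs (⇓exit r) le q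
    ... | runs {result = inj₁ s′} {time = t₁} {rest} r₁ le₁ q
      with runs {time = t₂} r₂ le₂ q₂
             ← go (smaller (ℕ.≤-trans (ℕ.+-monoˡ-≤ rest (time-positive r₁)) le₁)) q =
      runs (⇓again r₁ r₂) (sequence-time t₁ t₂ le₁ le₂) q₂

  -- `I` is the loop invariant, and `P x` is what treating the entry `x` achieves. Every round must
  -- preserve `P y` for all `y`, which is why `P` holds for all entries at the end.
  forEach-runs : ∀ {body : A → Prog ⊤} {c} (I : Store → Set) (P : A → Store → Set) xs →
                 (∀ {x σ} → x ∈ xs → I σ →
                    Runs′ (body x) σ c λ _ σ′ → I σ′ × P x σ′ × (∀ {y} → P y σ → P y σ′)) →
                 I σ →
                 Runs′ (forEach xs body) σ (length xs * c + 1) λ _ σ′ →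
                   I σ′ × (∀ {y} → y ∈ xs → P y σ′) × (∀ {y} → P y σ → P y σ′)
  forEach-runs I P []       step i = return-runs (i , (λ ()) , id)
  forEach-runs {c = c} I P (x ∷ xs) step i =
    weaken (ℕ.≤-reflexive (sym (ℕ.+-assoc c (length xs * c) 1)))
      (call (step (here refl) i) λ (i′ , Px , keep) →
        consequence
          (λ (i″ , Pxs , keep′) →
             i″ , (λ { (here refl) → keep′ Px ; (there y∈) → Pxs y∈ }) , keep′ ∘ keep)
          (forEach-runs I P xs (step ∘ there) i′))

  forAllFin-runs : ∀ {l c} {body : Fin l → Prog ⊤} (I : Store → Set) (P : Fin l → Store → Set) →
                   (∀ {x σ} → I σ →
                      Runs′ (body x) σ c λ _ σ′ → I σ′ × P x σ′ × (∀ {y} → P y σ → P y σ′)) →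
                   I σ →
                   Runs′ (forEach (allFin l) body) σ (l * c + 1) λ _ σ′ → I σ′ × (∀ y → P y σ′)
  forAllFin-runs {l = l} {c} I P step i =
    weaken (ℕ.≤-reflexive (cong (λ k → k * c + 1) (length-tabulate {n = l} id)))
      (consequence (λ (i′ , all , _) → i′ , λ y → all (∈-allFin y))
        (forEach-runs I P (allFin l) (λ _ → step) i))

  -- An eliminator with an explicit motive `P`, so that nested overrides can be analysed one
  -- comparison at a time.
  override-elim : ∀ {I : Set} (_≡?_ : DecidableEquality I) (f : I → A) i {x} j (P : A → Set) →
                  (i ≡ j → P x) → (i ≢ j → P (f j)) → P (override _≡?_ f i x j)
  override-elim _≡?_ f i j P eq neq with i ≡? j
  ... | yes i≡j = eq i≡j
  ... | no  i≢j = neq i≢j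

  override-same : ∀ {I : Set} (_≡?_ : DecidableEquality I) (f : I → A) i {x} → override _≡?_ f i x i ≡ x
  override-same _≡?_ f i {x} =
    override-elim _≡?_ f i i (_≡ x) (λ _ → refl) λ i≢i → contradiction refl i≢i

  override-other : ∀ {I : Set} (_≡?_ : DecidableEquality I) (f : I → A) {i x j} → i ≢ j →
                   override _≡?_ f i x j ≡ f j
  override-other _≡?_ f {i} {x} {j} i≢j =
    override-elim _≡?_ f i j (_≡ f j) (λ i≡j → contradiction i≡j i≢j) (λ _ → refl)

-- Walks, cycles and adjacency lists

module Walks
  (V : OrderedAbelianGroup) {n m : ℕ} (G : WeightedMultidigraph V n m) where

  open WeightedCycleDeletion V G

  Step : (Edge → Bool) → Vertex → Vertex → Set
  Step E u v = ∃ λ f → E f ≡ true × src f ≡ u × tgt f ≡ v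

  Walk : (Edge → Bool) → Vertex → Vertex → Set
  Walk E = Star (Step E)

  Cycle : (Edge → Bool) → Set
  Cycle E = ∃ λ f → E f ≡ true × Walk E (tgt f) (src f)

  _⊆ᵉ_ : (Edge → Bool) → (Edge → Bool) → Set
  E′ ⊆ᵉ E = ∀ f → E′ f ≡ true → E f ≡ true

  _without_ : (Edge → Bool) → Edge → Edge → Bool
  (E without e) f = if does (e Fin.≟ f) then false else E f

  without-≢ : ∀ E {e f} → e ≢ f → E f ≡ true → (E without e) f ≡ true
  without-≢ E {e} {f} e≢f Ef with e Fin.≟ f
  ... | yes e≡f = contradiction e≡f e≢f
  ... | no  _   = Ef

  without-⊆ : ∀ {E E′ e} → (∀ {f} → e ≢ f → E′ f ≡ true → E f ≡ true) → (E′ without e) ⊆ᵉ E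
  without-⊆ {e = e} sub f with e Fin.≟ f
  ... | yes _   = λ ()
  ... | no  e≢f = sub e≢f

  without-mono : ∀ {E E′ e} → E′ ⊆ᵉ E → (E′ without e) ⊆ᵉ (E without e)
  without-mono {e = e} sub f with e Fin.≟ f
  ... | yes _ = λ ()
  ... | no  _ = sub f

  cycle-mono : ∀ {E E′} → E′ ⊆ᵉ E → Cycle E′ → Cycle E
  cycle-mono sub (f , E′f , walk) =
    f , sub f E′f , Star.map (λ (g , E′g , s , t) → g , sub g E′g , s , t) walk

  split-walk : ∀ {E} e {u v} → Walk E u v →
               Walk (E without e) u v ⊎ (E e ≡ true × Walk E u (src e) × Walk E (tgt e) v)
  split-walk e ε = inj₁ ε
  split-walk {E} e ((f , Ef , refl , refl) ◅ walk) with e Fin.≟ f | split-walk e walk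
  ... | yes refl | _                     = inj₂ (Ef , ε , walk)
  ... | no e≢f   | inj₁ walk′            = inj₁ ((f , without-≢ E e≢f Ef , refl , refl) ◅ walk′)
  ... | no e≢f   | inj₂ (Ee , to , from) = inj₂ (Ee , (f , Ef , refl , refl) ◅ to , from)

  -- A cycle must pass through `e`, as it would otherwise survive without `e`. Cutting it at `e` and
  -- rotating gives the walk from the head of `e` back to its tail.
  cycle-through : ∀ {E} e → ¬ Cycle (E without e) → Cycle E → E e ≡ true × Walk E (tgt e) (src e)
  cycle-through {E} e acyclic (f , Ef , walk) with e Fin.≟ f | split-walk e walk
  ... | yes refl | _                     = Ef , walk
  ... | no e≢f   | inj₁ walk′            = contradiction (f , without-≢ E e≢f Ef , walk′) acyclic
  ... | no e≢f   | inj₂ (Ee , to , from) = Ee , (from ◅◅ (f , Ef , refl , refl) ◅ to)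

  -- `listed` is an inclusion only, since the lists keep removed edges; this makes the property
  -- stable under shrinking `E`. The length bound `total≤m` is therefore a separate field.
  record AdjacencyFor (E : Edge → Bool) (A : Vertex → List Edge) : Set where
    field
      listed  : ∀ {f} → E f ≡ true → f ∈ A (src f)
      source  : ∀ {v f} → f ∈ A v → src f ≡ v
      total≤m : total (length ∘ A) ≤ m

  adjacency-⊆ : ∀ {E E′ A} → E′ ⊆ᵉ E → AdjacencyFor E A → AdjacencyFor E′ A
  adjacency-⊆ sub adjacency = record
    { listed  = λ {f} E′f → listed (sub f E′f)
    ; source  = source
    ; total≤m = total≤m
    }
    where open AdjacencyFor adjacency

-- Binary heap: the position index and the depth of sifting

module HeapOperations
  (V : OrderedAbelianGroup) {n m : ℕ} (G : WeightedMultidigraph V n m)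
  (D : ℕ) (n<2^D : n < 2 ^ D) where

  open WeightedCycleDeletion V G
  open ProgramLogic V G
  open Store

  record IsHeapIndex (h : ℕ → Vertex) (p : Vertex → ℕ) (s : ℕ) : Set where
    field
      pos-heap : ∀ {i} → 1 ≤ i → i ≤ s → p (h i) ≡ i
      heap-pos : ∀ {v} → 1 ≤ p v → h (p v) ≡ v
      pos≤size : ∀ v → p v ≤ s

    heap-injective : ∀ {i j} → 1 ≤ i → i ≤ s → 1 ≤ j → j ≤ s → h i ≡ h j → i ≡ j
    heap-injective 1≤i i≤s 1≤j j≤s hi≡hj =
      trans (sym (pos-heap 1≤i i≤s)) (trans (cong p hi≡hj) (pos-heap 1≤j j≤s))

    -- Pigeonhole: `heap` is injective on the positions in use. With `n < 2 ^ D` this bounds the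
    -- depth of every position.
    size≤n : s ≤ n
    size≤n = Fin.injective⇒≤ {f = λ (i : Fin s) → h (suc (toℕ i))} λ {i} {j} eq →
      Fin.toℕ-injective (ℕ.suc-injective
        (heap-injective (s≤s z≤n) (Fin.toℕ<n i) (s≤s z≤n) (Fin.toℕ<n j) eq))

    size<2^D : s < 2 ^ D
    size<2^D = ℕ.≤-<-trans size≤n n<2^D

  Queued : (Vertex → ℕ) → Vertex → Set
  Queued p v = 1 ≤ p v

  SameQueue : (p p′ : Vertex → ℕ) → Set
  SameQueue p p′ = ∀ v → (Queued p v → Queued p′ v) × (Queued p′ v → Queued p v)

  withHeap : Store → (ℕ → Vertex) → (Vertex → ℕ) → ℕ → Store
  withHeap σ h p s = record σ { heapₛ = h ; posₛ = p ; sizeₛ = λ _ → s }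

  HeapIndexOf : Store → Set
  HeapIndexOf σ = IsHeapIndex (heapₛ σ) (posₛ σ) (sizeₛ σ tt)

  -- Being indexed by the final store, a match on `resifted` turns that store into a record update
  -- of the initial one. All other arrays are then unchanged by computation and no frame conditions
  -- arise. The later outcome types use the same device.
  data Resifted (σ : Store) : Store → Set where
    resifted : ∀ {h p} → IsHeapIndex h p (sizeₛ σ tt) → SameQueue (posₛ σ) p →
               Resifted σ (withHeap σ h p (sizeₛ σ tt))

  module _ {h p s} (ix : IsHeapIndex h p s) {i j} (1≤i : 1 ≤ i) (i≤s : i ≤ s) (1≤j : 1 ≤ j) (j≤s : j ≤ s) where
    open IsHeapIndex ix
    private
      v = h i
      w = h j
      h₁ = override ℕ._≟_ h i w
      p₁ = override Fin._≟_ p w i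
      h₂ = override ℕ._≟_ h₁ j v
      p₂ = override Fin._≟_ p₁ v j

    -- The second pair of writes takes precedence over the first. The hypotheses allow `i ≡ j`;
    -- equal vertices at the two positions force this case by injectivity.
    swap-heapIndex : IsHeapIndex h₂ p₂ s
    swap-heapIndex = record
      { pos-heap = λ {x} 1≤x x≤s →
          override-elim ℕ._≟_ h₁ j x (λ u → p₂ u ≡ x)
            (λ j≡x → trans (override-same Fin._≟_ p₁ v) j≡x)
            λ j≢x → override-elim ℕ._≟_ h i x (λ u → p₂ u ≡ x)
              (λ i≡x → override-elim Fin._≟_ p₁ v w (_≡ x)
                (λ v≡w → trans (sym (heap-injective 1≤i i≤s 1≤j j≤s v≡w)) i≡x)
                (λ v≢w → trans (override-same Fin._≟_ p w) i≡x))
              λ i≢x → override-elim Fin._≟_ p₁ v (h x) (_≡ x)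
                (λ v≡ → contradiction (heap-injective 1≤i i≤s 1≤x x≤s v≡) i≢x)
                λ v≢ → override-elim Fin._≟_ p w (h x) (_≡ x)
                  (λ w≡ → contradiction (heap-injective 1≤j j≤s 1≤x x≤s w≡) j≢x)
                  λ _ → pos-heap 1≤x x≤s
      ; heap-pos = λ {u} →
          override-elim Fin._≟_ p₁ v u (λ q → 1 ≤ q → h₂ q ≡ u)
            (λ v≡u _ → trans (override-same ℕ._≟_ h₁ j) v≡u)
            λ v≢u → override-elim Fin._≟_ p w u (λ q → 1 ≤ q → h₂ q ≡ u)
              (λ w≡u _ → override-elim ℕ._≟_ h₁ j i (_≡ u)
                (λ j≡i → trans (cong h (sym j≡i)) w≡u)
                (λ _ → trans (override-same ℕ._≟_ h i) w≡u))
              λ w≢u 1≤pu → override-elim ℕ._≟_ h₁ j (p u) (_≡ u)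
                (λ j≡pu → contradiction (trans (cong h j≡pu) (heap-pos 1≤pu)) w≢u)
                λ _ → override-elim ℕ._≟_ h i (p u) (_≡ u)
                  (λ i≡pu → contradiction (trans (cong h i≡pu) (heap-pos 1≤pu)) v≢u)
                  λ _ → heap-pos 1≤pu
      ; pos≤size = λ u →
          override-elim Fin._≟_ p₁ v u (_≤ s) (λ _ → j≤s)
            λ _ → override-elim Fin._≟_ p w u (_≤ s) (λ _ → i≤s) λ _ → pos≤size u
      }

    swap-sameQueue : SameQueue p p₂
    swap-sameQueue u =
      override-elim Fin._≟_ p₁ v u (λ q → (1 ≤ p u → 1 ≤ q) × (1 ≤ q → 1 ≤ p u))
        (λ { refl → (λ _ → 1≤j) , (λ _ → subst (1 ≤_) (sym (pos-heap 1≤i i≤s)) 1≤i) })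
        λ _ → override-elim Fin._≟_ p w u (λ q → (1 ≤ p u → 1 ≤ q) × (1 ≤ q → 1 ≤ p u))
          (λ { refl → (λ _ → 1≤i) , (λ _ → subst (1 ≤_) (sym (pos-heap 1≤j j≤s)) 1≤j) })
          λ _ → id , id

  resifted-trans : ∀ {σ h p σ″} → SameQueue (posₛ σ) p →
                   Resifted (withHeap σ h p (sizeₛ σ tt)) σ″ → Resifted σ σ″
  resifted-trans same (resifted ix same′) =
    resifted ix λ v → proj₁ (same′ v) ∘ proj₁ (same v) , proj₂ (same v) ∘ proj₂ (same′ v)

  resifted-refl : ∀ {σ} → HeapIndexOf σ → Resifted σ σ
  resifted-refl ix = resifted ix λ _ → id , id

  half-double≤ : ∀ i → ⌊ i /2⌋ + ⌊ i /2⌋ ≤ i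
  half-double≤ i = ℕ.≤-trans (ℕ.+-monoʳ-≤ ⌊ i /2⌋ (ℕ.⌊n/2⌋≤⌈n/2⌉ i)) (ℕ.≤-reflexive (ℕ.⌊n/2⌋+⌈n/2⌉≡n i))

  half<2^ : ∀ d {i} → i < 2 ^ suc d → ⌊ i /2⌋ < 2 ^ d
  half<2^ d {i} i<2^ with ⌊ i /2⌋ ℕ.<? 2 ^ d
  ... | yes lt = lt
  ... | no  ge = contradiction i<2^ (ℕ.≤⇒≯ (ℕ.≤-trans
    (ℕ.+-mono-≤ (ℕ.≮⇒≥ ge) (ℕ.≤-trans (ℕ.≤-reflexive (ℕ.+-identityʳ _)) (ℕ.≮⇒≥ ge))) (half-double≤ i)))

  -- Halving the position lowers `d` by one, and position 0 is never entered. A round takes at most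
  -- 9 steps: four reads, the four writes of two calls of `place`, and a return.
  siftUp-runs : ∀ d {i σ} → 1 ≤ i → i < 2 ^ d → i ≤ sizeₛ σ tt → HeapIndexOf σ →
                Runs′ (siftUp i) σ (d * 9) λ _ σ′ → Resifted σ σ′
  siftUp-runs zero    1≤i i<1 i≤s ix = contradiction 1≤i (ℕ.<⇒≱ i<1)
  siftUp-runs (suc d) {i} {σ} 1≤i i<2^ i≤s ix =
    loop-unfold {Q = Q} body
      (λ { (refl , refl , 1≤j , resifted ix′ same) →
           consequence (resifted-trans same)
             (siftUp-runs d 1≤j (half<2^ d i<2^) (ℕ.≤-trans (ℕ.⌊n/2⌋≤n i) i≤s) ix′) })
      id
    where
    Q : ℕ ⊎ ⊤ → Store → ℕ → Set
    Q (inj₁ j) σ′ k′ = j ≡ ⌊ i /2⌋ × k′ ≡ d * 9 × 1 ≤ ⌊ i /2⌋ × Resifted σ σ′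
    Q (inj₂ _) σ′ k′ = Resifted σ σ′

    v = heapₛ σ i
    w = heapₛ σ ⌊ i /2⌋

    body : Runs (siftUpStep i) σ (9 + d * 9) Q
    body =
      if-runs (i ℕ.≤? 1) (λ _ → return-runs (resifted-refl ix)) λ i≰1 →
      let 1≤j = ℕ.⌊n/2⌋-mono (ℕ.≰⇒> i≰1) ; j≤s = ℕ.≤-trans (ℕ.⌊n/2⌋≤n i) i≤s in
      read-bind (read-bind (read-bind (read-bind
        (if-runs (distₛ σ v ≤±? distₛ σ w) (λ _ → return-runs (resifted-refl ix)) λ _ →
          place-bind (place-bind (return-runs
            (refl , refl , 1≤j ,
             resifted (swap-heapIndex ix 1≤i i≤s 1≤j j≤s) (swap-sameQueue ix 1≤i i≤s 1≤j j≤s))))))))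

  largerChild-runs : ∀ {k i σ} → i + i ≤ k →
                     Runs′ (largerChild k i) σ 5 λ j σ′ → σ′ ≡ σ × i + i ≤ j × j ≤ k
  largerChild-runs {k} {i} {σ} l≤k =
    if-runs (suc (i + i) ℕ.≤? k)
      (λ r≤k → read-bind (read-bind (read-bind (read-bind (return-runs
        (choose (distₛ σ (heapₛ σ (suc (i + i))) ≤±? distₛ σ (heapₛ σ (i + i))) r≤k))))))
      λ _ → return-runs (refl , ℕ.≤-refl , l≤k)
    where
    choose : ∀ {P : Set} (d : Dec P) → suc (i + i) ≤ k →
             let j = if does d then i + i else suc (i + i) in σ ≡ σ × i + i ≤ j × j ≤ k
    choose (yes _) r≤k = refl , ℕ.≤-refl , l≤k
    choose (no _)  r≤k = refl , ℕ.n≤1+n _ , r≤k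

  -- Passing to a child at least doubles the position, hence lowers `d` by one. The 15 steps are the
  -- read of `size`, five for `largerChild`, four reads, four writes and a return; the extra round
  -- in `suc d` is the one that stops.
  siftDown-runs : ∀ d {i σ} → 1 ≤ i → sizeₛ σ tt < i * 2 ^ d → HeapIndexOf σ →
                  Runs′ (siftDown i) σ (suc d * 15) λ _ σ′ → Resifted σ σ′
  siftDown-runs d {i} {σ} 1≤i s<i*2^ ix =
    loop-unfold {Q = Q} body again id
    where
    s = sizeₛ σ tt

    Q : ℕ ⊎ ⊤ → Store → ℕ → Set
    Q (inj₁ j) σ′ k′ = k′ ≡ d * 15 × i + i ≤ j × j ≤ s × Resifted σ σ′
    Q (inj₂ _) σ′ k′ = Resifted σ σ′

    body : Runs (siftDownStep i) σ (suc d * 15) Q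
    body =
      read-bind (if-runs ((i + i) ℕ.≤? s)
        (λ 2i≤s → call (largerChild-runs {i = i} 2i≤s) λ { {j} (refl , 2i≤j , j≤s) →
          let i≤j = ℕ.≤-trans (ℕ.m≤m+n i i) 2i≤j
              i≤s = ℕ.≤-trans i≤j j≤s
              1≤j = ℕ.≤-trans 1≤i i≤j in
          read-bind (read-bind (read-bind (read-bind
            (if-runs (distₛ σ (heapₛ σ j) ≤±? distₛ σ (heapₛ σ i)) (λ _ → return-runs (resifted-refl ix)) λ _ →
              place-bind (place-bind (return-runs
                (refl , 2i≤j , j≤s ,
                 resifted (swap-heapIndex ix 1≤i i≤s 1≤j j≤s) (swap-sameQueue ix 1≤i i≤s 1≤j j≤s)))))))) })
        λ _ → return-runs (resifted-refl ix))

    again : ∀ {j σ′ k′} → Q (inj₁ j) σ′ k′ → Runs (siftDown j) σ′ k′ λ _ σ″ _ → Resifted σ σ″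
    again {j} (refl , 2i≤j , j≤s , resifted ix′ same) = go d s<i*2^
      where
      i≤s = ℕ.≤-trans (ℕ.≤-trans (ℕ.m≤m+n i i) 2i≤j) j≤s
      -- After a swap `i` has a child within the heap, so `i ≤ s`, which excludes `d ≡ 0`.
      go : ∀ d → s < i * 2 ^ d → Runs (siftDown j) _ (d * 15) λ _ σ″ _ → Resifted σ σ″
      go zero    s<i*1 = contradiction (ℕ.<-≤-trans s<i*1 (ℕ.≤-reflexive (ℕ.*-identityʳ i))) (ℕ.≤⇒≯ i≤s)
      go (suc d) s<i*2^ = consequence (resifted-trans same)
        (siftDown-runs d (ℕ.≤-trans 1≤i (ℕ.≤-trans (ℕ.m≤m+n i i) 2i≤j)) (ℕ.<-≤-trans s<i*2^ (begin
          i * (2 * 2 ^ d)  ≡⟨ ℕ.*-assoc i 2 (2 ^ d) ⟨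
          i * 2 * 2 ^ d    ≡⟨ cong (_* 2 ^ d) (trans (ℕ.*-comm i 2) (cong (i +_) (ℕ.+-identityʳ i))) ⟩
          (i + i) * 2 ^ d  ≤⟨ ℕ.*-monoˡ-≤ (2 ^ d) 2i≤j ⟩
          j * 2 ^ d        ∎)) ix′)
        where open ℕ.≤-Reasoning

  data Inserted (v : Vertex) (σ : Store) : Store → Set where
    inserted : ∀ {h p s} → IsHeapIndex h p s →
               Queued p v → (∀ {u} → Queued (posₛ σ) u → Queued p u) →
               (∀ {u} → Queued p u → v ≡ u ⊎ Queued (posₛ σ) u) →
               Inserted v σ (withHeap σ h p s)

  insertCost extractCost : ℕ
  insertCost  = 4 + D * 9
  extractCost = 7 + (suc D * 15 + 1)

  append-heapIndex : ∀ {h p s v} → IsHeapIndex h p s → p v ≡ 0 →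
                     IsHeapIndex (override ℕ._≟_ h (suc s) v) (override Fin._≟_ p v (suc s)) (suc s)
  append-heapIndex {h} {p} {s} {v} ix pv≡0 = record
    { pos-heap = λ {x} 1≤x x≤1+s →
        override-elim ℕ._≟_ h (suc s) x (λ u → p₁ u ≡ x)
          (λ 1+s≡x → trans (override-same Fin._≟_ p v) 1+s≡x)
          λ 1+s≢x →
            let x≤s = ℕ.≤-pred (ℕ.≤∧≢⇒< x≤1+s (≢-sym 1+s≢x)) in
            override-elim Fin._≟_ p v (h x) (_≡ x)
              (λ v≡ → contradiction 1≤x
                (ℕ.<⇒≱ (s≤s (ℕ.≤-reflexive (trans (sym (pos-heap 1≤x x≤s)) (trans (cong p (sym v≡)) pv≡0))))))
              λ _ → pos-heap 1≤x x≤s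
    ; heap-pos = λ {u} →
        override-elim Fin._≟_ p v u (λ q → 1 ≤ q → h₁ q ≡ u)
          (λ v≡u _ → trans (override-same ℕ._≟_ h (suc s)) v≡u)
          λ _ 1≤pu → trans (override-other ℕ._≟_ h (ℕ.<⇒≢ (s≤s (pos≤size u)) ∘ sym)) (heap-pos 1≤pu)
    ; pos≤size = λ u →
        override-elim Fin._≟_ p v u (_≤ suc s) (λ _ → ℕ.≤-refl) λ _ → ℕ.m≤n⇒m≤1+n (pos≤size u)
    }
    where
    open IsHeapIndex ix
    h₁ = override ℕ._≟_ h (suc s) v
    p₁ = override Fin._≟_ p v (suc s)

  insert-runs : ∀ {v σ} → HeapIndexOf σ → posₛ σ v ≡ 0 →
                Runs′ (insert v) σ insertCost λ _ σ′ → Inserted v σ σ′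
  insert-runs {v} {σ} ix pv≡0 =
    read-bind (write-bind (place-bind (consequence weakenPost
      (siftUp-runs D (s≤s z≤n) (IsHeapIndex.size<2^D ix′) ℕ.≤-refl ix′))))
    where
    s = sizeₛ σ tt
    p = posₛ σ
    p₁ = override Fin._≟_ p v (suc s)
    ix′ = append-heapIndex ix pv≡0

    weakenPost : ∀ {σ′} → Resifted (withHeap σ (override ℕ._≟_ (heapₛ σ) (suc s) v) p₁ (suc s)) σ′ →
                 Inserted v σ σ′
    weakenPost (resifted ix″ same) = inserted ix″
      (proj₁ (same v) (subst (1 ≤_) (sym (override-same Fin._≟_ p v)) (s≤s z≤n)))
      (λ {u} 1≤pu → proj₁ (same u) (override-elim Fin._≟_ p v u (1 ≤_) (λ _ → s≤s z≤n) λ _ → 1≤pu))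
      (λ {u} 1≤p′u → override-elim Fin._≟_ p v u (λ q → 1 ≤ q → v ≡ u ⊎ 1 ≤ p u)
        (λ v≡u _ → inj₁ v≡u) (λ _ → inj₂) (proj₂ (same u) 1≤p′u))

  data Extracted (σ : Store) : Maybe Vertex → Store → Set where
    none : (∀ v → ¬ Queued (posₛ σ) v) → Extracted σ nothing σ
    some : ∀ {v h p s} → IsHeapIndex h p s → Queued (posₛ σ) v → ¬ Queued p v →
           (∀ {u} → v ≢ u → (Queued (posₛ σ) u → Queued p u) × (Queued p u → Queued (posₛ σ) u)) →
           Extracted σ (just v) (withHeap σ h p s)

  module _ {h p s} (ix : IsHeapIndex h p (suc s)) where
    open IsHeapIndex ix
    private
      v = h 1
      w = h (suc s)
      h₁ = override ℕ._≟_ h 1 w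
      p₁ = override Fin._≟_ p w 1
      p₂ = override Fin._≟_ p₁ v 0

      v≡w⇒s≡0 : v ≡ w → 0 ≡ s
      v≡w⇒s≡0 = ℕ.suc-injective ∘ heap-injective ℕ.≤-refl (s≤s z≤n) (s≤s z≤n) ℕ.≤-refl

    -- The delicate case is a heap with one vertex, where `v` and `w` coincide: the write of 0 into
    -- `pos` comes last and wins, and no position remains to be checked.
    removeFirst-heapIndex : IsHeapIndex h₁ p₂ s
    removeFirst-heapIndex = record
      { pos-heap = λ {x} 1≤x x≤s →
          override-elim ℕ._≟_ h 1 x (λ u → p₂ u ≡ x)
            (λ 1≡x → override-elim Fin._≟_ p₁ v w (_≡ x)
              (λ v≡w → contradiction (ℕ.≤-trans 1≤x x≤s) (ℕ.<⇒≱ (s≤s (ℕ.≤-reflexive (sym (v≡w⇒s≡0 v≡w))))))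
              (λ _ → trans (override-same Fin._≟_ p w) 1≡x))
            λ 1≢x → override-elim Fin._≟_ p₁ v (h x) (_≡ x)
              (λ v≡ → contradiction (heap-injective ℕ.≤-refl (s≤s z≤n) 1≤x (ℕ.m≤n⇒m≤1+n x≤s) v≡) 1≢x)
              λ _ → override-elim Fin._≟_ p w (h x) (_≡ x)
                (λ w≡ → contradiction (heap-injective (s≤s z≤n) ℕ.≤-refl 1≤x (ℕ.m≤n⇒m≤1+n x≤s) w≡)
                          (ℕ.<⇒≢ (s≤s x≤s) ∘ sym))
                λ _ → pos-heap 1≤x (ℕ.m≤n⇒m≤1+n x≤s)
      ; heap-pos = λ {u} →
          override-elim Fin._≟_ p₁ v u (λ q → 1 ≤ q → h₁ q ≡ u) (λ _ ())
            λ v≢u → override-elim Fin._≟_ p w u (λ q → 1 ≤ q → h₁ q ≡ u)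
              (λ w≡u _ → trans (override-same ℕ._≟_ h 1) w≡u)
              λ w≢u 1≤pu → override-elim ℕ._≟_ h 1 (p u) (_≡ u)
                (λ 1≡pu → contradiction (trans (cong h 1≡pu) (heap-pos 1≤pu)) v≢u)
                λ _ → heap-pos 1≤pu
      ; pos≤size = λ u →
          override-elim Fin._≟_ p₁ v u (_≤ s) (λ _ → z≤n)
            λ v≢u → override-elim Fin._≟_ p w u (_≤ s)
              (λ w≡u → ℕ.n≢0⇒n>0 λ s≡0 → v≢u (trans (cong (h ∘ suc) (sym s≡0)) w≡u))
              λ w≢u → ℕ.≤-pred (ℕ.≤∧≢⇒< (pos≤size u) λ pu≡1+s →
                w≢u (trans (cong h (sym pu≡1+s)) (heap-pos (subst (1 ≤_) (sym pu≡1+s) (s≤s z≤n)))))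
      }

    removeFirst-notQueued : ¬ Queued p₂ v
    removeFirst-notQueued 1≤p₂v =
      contradiction (ℕ.≤-trans 1≤p₂v (ℕ.≤-reflexive (override-same Fin._≟_ p₁ v))) λ ()

    removeFirst-othersQueued : ∀ {u} → v ≢ u → (Queued p u → Queued p₂ u) × (Queued p₂ u → Queued p u)
    removeFirst-othersQueued {u} v≢u =
      override-elim Fin._≟_ p₁ v u (λ q → (1 ≤ p u → 1 ≤ q) × (1 ≤ q → 1 ≤ p u))
        (λ v≡u → contradiction v≡u v≢u)
        λ _ → override-elim Fin._≟_ p w u (λ q → (1 ≤ p u → 1 ≤ q) × (1 ≤ q → 1 ≤ p u))
          (λ { refl → (λ _ → s≤s z≤n)
                    , (λ _ → subst (1 ≤_) (sym (pos-heap (s≤s z≤n) ℕ.≤-refl)) (s≤s z≤n)) })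
          λ _ → id , id

  extractMax-runs : ∀ {σ} → HeapIndexOf σ → Runs′ extractMax σ extractCost (Extracted σ)
  extractMax-runs {σ} ix = read-bind (from (sizeₛ σ tt) refl)
    where
    open IsHeapIndex ix
    from : ∀ k → k ≡ sizeₛ σ tt → Runs′ (extractMaxFrom k) σ (6 + (suc D * 15 + 1)) (Extracted σ)
    from zero    0≡s = return-runs (none λ v 1≤pv →
      contradiction (ℕ.≤-trans 1≤pv (ℕ.≤-trans (pos≤size v) (ℕ.≤-reflexive (sym 0≡s)))) λ ())
    from (suc k) 1+k≡s =
      read-bind (read-bind (write-bind (place-bind (write-bind
        (call (siftDown-runs D ℕ.≤-refl k<2^D ix₁) λ { (resifted ix₂ same) → return-runs
          (some ix₂
            (subst (1 ≤_) (sym (pos-heap ℕ.≤-refl (ℕ.≤-trans (s≤s z≤n) (ℕ.≤-reflexive 1+k≡s)))) ℕ.≤-refl)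
            (removeFirst-notQueued ix′ ∘ proj₂ (same _))
            λ {u} v≢u → let q , q′ = removeFirst-othersQueued ix′ v≢u in
              proj₁ (same u) ∘ q , q′ ∘ proj₂ (same u)) })))))
      where
      ix′ : IsHeapIndex (heapₛ σ) (posₛ σ) (suc k)
      ix′ = subst (IsHeapIndex (heapₛ σ) (posₛ σ)) (sym 1+k≡s) ix
      ix₁ = removeFirst-heapIndex ix′
      k<2^D : k < 1 * 2 ^ D
      k<2^D = ℕ.<-≤-trans (IsHeapIndex.size<2^D ix₁) (ℕ.≤-reflexive (sym (ℕ.*-identityˡ _)))

-- Widest-path search: every vertex is scanned at most once

module PathSearch
  (V : OrderedAbelianGroup) {n m : ℕ} (G : WeightedMultidigraph V n m)
  (D : ℕ) (n<2^D : n < 2 ^ D) where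

  open WeightedCycleDeletion V G
  open ProgramLogic V G
  open Walks V G
  open HeapOperations V G D n<2^D
  open Store

  private
    module Order = IsDecTotalOrder (OrderedAbelianGroup.isDecTotalOrder V)
    module Order± = AddExtrema (OrderedAbelianGroup._≤_ V)

  ≤±-refl : ∀ {x} → x ≤± x
  ≤±-refl = Order±.≤±-reflexive-≡ (λ { refl → Order.refl }) refl

  ≤±-trans : ∀ {x y z} → x ≤± y → y ≤± z → x ≤± z
  ≤±-trans = Order±.≤±-trans Order.trans

  ≰±⇒≥± : ∀ {x y} → ¬ x ≤± y → y ≤± x
  ≰±⇒≥± {x} {y} x≰y with Order±.≤±-total Order.total x y
  ... | inj₁ x≤y = contradiction x≤y x≰y
  ... | inj₂ y≤x = y≤x

  ≤±-≢⊥± : ∀ {x y} → x ≤± y → x ≢ ⊥± → y ≢ ⊥±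
  ≤±-≢⊥± Order±.⊥±≤⊥± x≢⊥ refl = x≢⊥ refl

  min±-≤ˡ : ∀ x y → min± x y ≤± x
  min±-≤ˡ x y with x ≤±? y
  ... | yes _   = ≤±-refl
  ... | no  x≰y = ≰±⇒≥± x≰y

  min±-≢⊥± : ∀ {x y} → x ≢ ⊥± → y ≢ ⊥± → min± x y ≢ ⊥±
  min±-≢⊥± {x} {y} x≢⊥ y≢⊥ with x ≤±? y
  ... | yes _ = x≢⊥
  ... | no  _ = y≢⊥

  Reached : (Vertex → Value±) → Vertex → Set
  Reached d v = d v ≢ ⊥±

  withSearch : Store → (Vertex → Value±) → (Vertex → Edge) → (Vertex → Edge) →
               (ℕ → Vertex) → (Vertex → ℕ) → ℕ → Store
  withSearch σ d r b h p s =
    record σ { distₛ = d ; parentₛ = r ; bestₛ = b ; heapₛ = h ; posₛ = p ; sizeₛ = λ _ → s }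

  relaxCost : ℕ
  relaxCost = 5 + insertCost

  scanCost : ℕ → ℕ
  scanCost l = 1 + ((l * 2 + 1) + ((l * 5 + 1) + (l * (2 + relaxCost) + 1)))

  searchCost maxflowCost : ℕ
  searchCost  = (n * 2 + 1) + (2 + (insertCost +
                  (extractCost + suc (n * (5 + extractCost) + m * (9 + relaxCost)))))
  maxflowCost = searchCost + (2 + ((n * 2 + 1) + 1))

  module Searching (σ₀ : Store) (adjacency : AdjacencyFor (inHₛ σ₀) (adjₛ σ₀)) (x : Vertex) where
    open AdjacencyFor adjacency

    H : Edge → Bool
    H = inHₛ σ₀

    A : Vertex → List Edge
    A = adjₛ σ₀

    private variable
      d d′ : Vertex → Value±
      r r′ b : Vertex → Edge
      h h′ : ℕ → Vertex
      p p′ : Vertex → ℕ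
      s s′ k : ℕ
      v ver : Vertex
      act : Vertex → Bool

    -- Parent edges lead back to x in k steps, and dist does not decrease along the way.
    data Chain (d : Vertex → Value±) (r : Vertex → Edge) : Vertex → ℕ → Set where
      root : Chain d r x 0
      link : ∀ {v f k} → v ≢ x → r v ≡ f → H f ≡ true → d v ≤± d (src f) → Chain d r (src f) k →
             Chain d r v (suc k)

    -- act marks the vertices that have not been extracted from the heap.
    record Invariant (act : Vertex → Bool) (d : Vertex → Value±) (r : Vertex → Edge)
                     (h : ℕ → Vertex) (p : Vertex → ℕ) (s : ℕ) : Set where
      field
        heapIndex        : IsHeapIndex h p s
        rootTop          : d x ≡ ⊤±
        chain            : Reached d v → ∃ (Chain d r v)
        queued⇒reached   : Queued p v → Reached d v
        queued⇒active    : Queued p v → act v ≡ true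
        unreached⇒active : d v ≡ ⊥± → act v ≡ true
        active⇒queued    : act v ≡ true → Reached d v → Queued p v

    module Raise {w f δ} (w≢x : w ≢ x) (Hf : H f ≡ true) (δ≤ : δ ≤± d (src f)) (δ≰ : ¬ δ ≤± d w) where
      d₁ : Vertex → Value±
      d₁ = override Fin._≟_ d w δ

      r₁ : (Vertex → Edge) → Vertex → Edge
      r₁ r = override Fin._≟_ r w f

      grows : ∀ v → d v ≤± d₁ v
      grows v = override-elim Fin._≟_ d w v (d v ≤±_) (λ { refl → ≰±⇒≥± δ≰ }) λ _ → ≤±-refl

      chain-keep : ∀ {u k f′} → w ≢ u → u ≢ x → r u ≡ f′ → H f′ ≡ true → d u ≤± d (src f′) →
                   Chain d₁ (r₁ r) (src f′) k → Chain d₁ (r₁ r) u (suc k)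
      chain-keep {r = r} {f′ = f′} w≢u u≢x ru≡ Hf′ le c =
        link u≢x (trans (override-other Fin._≟_ r w≢u) ru≡) Hf′
          (subst (_≤± d₁ (src f′)) (sym (override-other Fin._≟_ d w≢u)) (≤±-trans le (grows (src f′)))) c

      -- The vertices of a chain have dist at least that of its first vertex, so w is not among them.
      chain-avoiding : ∀ {u k} → δ ≤± d u → Chain d r u k → Chain d₁ (r₁ r) u k
      chain-avoiding δ≤du root = root
      chain-avoiding δ≤du (link u≢x ru≡ Hf′ le c) =
        chain-keep (λ { refl → δ≰ δ≤du }) u≢x ru≡ Hf′ le (chain-avoiding (≤±-trans δ≤du le) c)

      chain-new : Chain d r (src f) k → Chain d₁ (r₁ r) w (suc k)
      chain-new {r = r} c =
        link w≢x (override-same Fin._≟_ r w) Hf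
          (subst (_≤± d₁ (src f)) (sym (override-same Fin._≟_ d w)) (≤±-trans δ≤ (grows (src f))))
          (chain-avoiding δ≤ c)

      -- A chain that meets `w` is cut there and continued along the new parent edge `f`. Its length
      -- may change, hence the existential.
      chain-update : ∀ {u k j} → Chain d r (src f) k → Chain d r u j → ∃ (Chain d₁ (r₁ r) u)
      chain-update cf root = 0 , root
      chain-update {u = u} cf (link u≢x ru≡ Hf′ le c) with w Fin.≟ u
      ... | yes refl = -, chain-new cf
      ... | no  w≢u  = -, chain-keep w≢u u≢x ru≡ Hf′ le (proj₂ (chain-update cf c))

      -- The new heap is arbitrary, which covers all outcomes of `requeue`: no change, sifting and
      -- insertion. Only a vertex with dist -∞ may be newly queued, and such a vertex is still
      -- active; so nothing is queued again after its extraction.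
      invariant : ∀ {r} → δ ≢ ⊥± → Invariant act d r h p s → IsHeapIndex h′ p′ s′ →
                  (∀ {u} → Queued p u → Queued p′ u) →
                  (∀ {u} → Queued p′ u → (w ≡ u × d w ≡ ⊥±) ⊎ Queued p u) →
                  Reached d w ⊎ Queued p′ w →
                  Invariant act d₁ (r₁ r) h′ p′ s′
      invariant {act = act} {p′ = p′} {r = r} δ≢⊥ inv ix queued⇒ ⇒queued reached⊎queued = record
        { heapIndex        = ix
        ; rootTop          = trans (override-other Fin._≟_ d w≢x) rootTop
        ; chain            = λ {v} → override-elim Fin._≟_ d w v (λ z → z ≢ ⊥± → ∃ (Chain d₁ (r₁ r) v))
                               (λ { refl _ → -, chain-new chain-src })
                               (λ _ reached → chain-update chain-src (proj₂ (chain reached)))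
        ; queued⇒reached   = λ {v} q → override-elim Fin._≟_ d w v (_≢ ⊥±) (λ _ → δ≢⊥) λ w≢v →
                               case ⇒queued q of λ { (inj₁ (w≡v , _)) → contradiction w≡v w≢v
                                                   ; (inj₂ q′) → queued⇒reached q′ }
        ; queued⇒active    = λ q → case ⇒queued q of λ { (inj₁ (refl , dw≡⊥)) → unreached⇒active dw≡⊥
                                                       ; (inj₂ q′) → queued⇒active q′ }
        ; unreached⇒active = λ {v} → override-elim Fin._≟_ d w v (λ z → z ≡ ⊥± → act v ≡ true)
                               (λ _ δ≡⊥ → contradiction δ≡⊥ δ≢⊥) λ _ → unreached⇒active
        ; active⇒queued    = λ {v} a → override-elim Fin._≟_ d w v (λ z → z ≢ ⊥± → Queued p′ v)
                               (λ { refl _ → [ queued⇒ ∘ active⇒queued a , id ]′ reached⊎queued })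
                               (λ _ → queued⇒ ∘ active⇒queued a)
        }
        where
        open Invariant inv
        chain-src = proj₂ (chain (≤±-≢⊥± δ≤ δ≢⊥))

    data Searched (act : Vertex → Bool) (b : Vertex → Edge) (d₀ : Vertex → Value±) : Store → Set where
      searched : Invariant act d r h p s → (∀ {v} → Reached d₀ v → Reached d v) →
                 Searched act b d₀ (withSearch σ₀ d r b h p s)

    relax-runs : ∀ {f} → Invariant act d r h p s → Reached d ver → src f ≡ ver → H f ≡ true →
                 Runs′ (relax ver f) (withSearch σ₀ d r b h p s) relaxCost
                   λ _ σ′ → Searched act b d σ′ × Reached (distₛ σ′) (tgt f)
    relax-runs {act} {d} {r} {h} {p} {s} {b = b} {f = f} inv ver-reached refl Hf =
      read-bind (read-bind (read-bind (if-runs (δ ≤±? d w)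
        (λ δ≤dw → return-runs (searched inv id , ≤±-≢⊥± δ≤dw δ≢⊥))
        λ δ≰dw → write-bind (write-bind (requeued δ≰dw)))))
      where
      open Invariant inv
      w = tgt f
      δ = min± (d (src f)) [ valₛ σ₀ f ]

      δ≢⊥ : δ ≢ ⊥±
      δ≢⊥ = min±-≢⊥± {y = [ valₛ σ₀ f ]} ver-reached λ ()

      module _ (δ≰dw : ¬ δ ≤± d w) where
        w≢x : w ≢ x
        w≢x refl = δ≰dw (subst (δ ≤±_) (sym rootTop) (Order±.≤±-maximum δ))

        open Raise {d = d} {w} {f} {δ} w≢x Hf (min±-≤ˡ (d (src f)) [ valₛ σ₀ f ]) δ≰dw
          using (d₁; r₁; grows; invariant)

        σ₁ : Store
        σ₁ = withSearch σ₀ d₁ (r₁ r) b h p s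

        Post : ⊤ → Store → ℕ → Set
        Post _ σ′ _ = Searched act b d σ′ × Reached (distₛ σ′) w

        grown : ∀ {v} → Reached d v → Reached d₁ v
        grown = ≤±-≢⊥± (grows _)

        w-reached : Reached d₁ w
        w-reached = subst (_≢ ⊥±) (sym (override-same Fin._≟_ d w)) δ≢⊥

        increase : Reached d w → ∀ i → i ≡ p w → Runs (increaseKey i) σ₁ (3 + D * 9) Post
        -- A reached vertex at position 0 has been extracted already. Without the heap order a raise
        -- of its dist cannot be excluded here; it is harmless, since the vertex is not queued
        -- again.
        increase reached zero    _     =
          return-runs (searched (invariant δ≢⊥ inv heapIndex id inj₂ (inj₁ reached)) grown , w-reached)
        increase reached (suc i) i≡pw =
          weaken (ℕ.m≤n+m _ 3) (consequence
            (λ { (resifted ix same) →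
                 searched (invariant δ≢⊥ inv ix (proj₁ (same _)) (inj₂ ∘ proj₂ (same _)) (inj₁ reached)) grown ,
                 w-reached })
            (siftUp-runs D (s≤s z≤n) (ℕ.≤-<-trans i≤s (IsHeapIndex.size<2^D heapIndex)) i≤s heapIndex))
          where
          i≤s : suc i ≤ s
          i≤s = subst (_≤ s) (sym i≡pw) (IsHeapIndex.pos≤size heapIndex w)

        requeue-from : ∀ z → z ≡ d w → Runs (requeue w z) σ₁ insertCost Post
        requeue-from ⊥± ⊥≡dw = consequence
          (λ { (inserted ix wq queued⇒ ⇒queued) →
               searched (invariant δ≢⊥ inv ix queued⇒
                 (λ q → case ⇒queued q of λ { (inj₁ w≡u) → inj₁ (w≡u , sym ⊥≡dw) ; (inj₂ q′) → inj₂ q′ })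
                 (inj₂ wq)) grown ,
               w-reached })
          (insert-runs heapIndex (ℕ.n<1⇒n≡0 (ℕ.≰⇒> λ q → queued⇒reached q (sym ⊥≡dw))))
        requeue-from [ _ ] z≡dw = read-bind (increase (λ dw≡⊥ → case trans z≡dw dw≡⊥ of λ ()) _ refl)
        requeue-from ⊤±    z≡dw = read-bind (increase (λ dw≡⊥ → case trans z≡dw dw≡⊥ of λ ()) _ refl)

        requeued : Runs (requeue w (d w)) σ₁ insertCost Post
        requeued = requeue-from (d w) refl

    -- This trace of a scan persists when dist grows, and it makes the set of reached vertices
    -- closed under edges of H in the end.
    Scanned : (Vertex → Value±) → Vertex → Set
    Scanned d v = ∀ {f} → f ∈ A v → H f ≡ true → Reached d (tgt f)

    module Scan (ver : Vertex) where
      Candidate : Edge → Vertex → Set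
      Candidate g w = src g ≡ ver × H g ≡ true × tgt g ≡ w

      -- The first pass overwrites whatever earlier scans left in `best`. From then on the entry at
      -- `tgt f` is some edge of H from `ver` with the same target as `f`, so relaxing it reaches
      -- `tgt f` as well.
      HasBest : (Vertex → Edge) → Edge → Set
      HasBest b f = H f ≡ true → Candidate (b (tgt f)) (tgt f)

      data Unchanged (σ : Store) : Store → Set where
        unchanged : ∀ {b} → Unchanged σ (record σ { bestₛ = b })

      write-best : ∀ {b e f} → e ∈ A ver → H e ≡ true → HasBest b f → HasBest (override Fin._≟_ b (tgt e) e) f
      write-best {b} {e} {f} e∈ He hb Hf =
        override-elim Fin._≟_ b (tgt e) (tgt f) (λ g → Candidate g (tgt f))
          (λ eq → source e∈ , He , eq) λ _ → hb Hf

      firstPass : ∀ {σ} → inHₛ σ ≡ H →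
                  Runs′ (forEach (A ver) λ e → ifInH e (write best (tgt e) e)) σ (length (A ver) * 2 + 1)
                    λ _ σ′ → Unchanged σ σ′ × (∀ {f} → f ∈ A ver → HasBest (bestₛ σ′) f)
      firstPass {σ} refl = consequence (λ (u , all , _) → u , all)
        (forEach-runs (Unchanged σ) (λ f σ′ → HasBest (bestₛ σ′) f) (A ver)
          (λ { {e} e∈ (unchanged {b}) → read-bind (if-bool-runs (H e)
            (λ He → write-runs (unchanged ,
              (λ _ → subst (λ g → Candidate g (tgt e)) (sym (override-same Fin._≟_ b (tgt e)))
                       (source e∈ , He , refl)) ,
              λ {f} → write-best {b} {e} {f} e∈ He))
            λ He → return-runs (unchanged , (λ He′ → case trans (sym He) He′ of λ ()) , id)) })
          unchanged)

      secondPass : ∀ {σ} → inHₛ σ ≡ H → (∀ {f} → f ∈ A ver → HasBest (bestₛ σ) f) →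
                   Runs′ (forEach (A ver) λ e → ifInH e (improveBest e)) σ (length (A ver) * 5 + 1)
                     λ _ σ′ → Unchanged σ σ′ × (∀ {f} → f ∈ A ver → HasBest (bestₛ σ′) f)
      secondPass {σ} refl all = consequence (λ (i , _) → i)
        (forEach-runs (λ σ′ → Unchanged σ σ′ × (∀ {f} → f ∈ A ver → HasBest (bestₛ σ′) f)) (λ _ _ → ⊤) (A ver)
          (λ { {e} e∈ (unchanged {b} , all) → read-bind (if-bool-runs (H e)
            (λ He → read-bind (read-bind (read-bind (if-runs (valₛ σ e ≤? valₛ σ (b (tgt e)))
              (λ _ → return-runs ((unchanged , all) , _))
              λ _ → write-runs ((unchanged , λ {f} f∈ → write-best {b} {e} {f} e∈ He (all f∈)) , _)))))
            λ _ → return-runs ((unchanged , all) , _)) })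
          (unchanged , all))

      thirdPass : Invariant act d r h p s → Reached d ver → (∀ {f} → f ∈ A ver → HasBest b f) →
                  Runs′ (forEach (A ver) λ e → ifInH e (read best (tgt e) >>= relax ver))
                    (withSearch σ₀ d r b h p s) (length (A ver) * (2 + relaxCost) + 1)
                    λ _ σ′ → Searched act b d σ′ × Scanned (distₛ σ′) ver
      thirdPass {act = act} {d = d} {b = b} inv ver-reached all = consequence (λ (i , Ps , _) → i , Ps)
        (forEach-runs (Searched act b d) (λ f σ′ → H f ≡ true → Reached (distₛ σ′) (tgt f)) (A ver)
          (λ { {e} e∈ (searched {d = d′} inv′ reached) → read-bind (if-bool-runs (H e)
            (λ He → read-bind (relaxBest inv′ reached (all e∈ He)))
            λ He → return-runs (searched inv′ reached , (λ He′ → case trans (sym He) He′ of λ ()) , id)) })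
          (searched inv id))
        where
        relaxBest : ∀ {g e d′ r′ h′ p′ s′} → Invariant act d′ r′ h′ p′ s′ →
                    (∀ {v} → Reached d v → Reached d′ v) → Candidate g (tgt e) →
                    Runs′ (relax ver g) (withSearch σ₀ d′ r′ b h′ p′ s′) relaxCost λ _ σ′ →
                      Searched act b d σ′ × (H e ≡ true → Reached (distₛ σ′) (tgt e)) ×
                      (∀ {f : Edge} → (H f ≡ true → Reached d′ (tgt f)) → H f ≡ true → Reached (distₛ σ′) (tgt f))
        relaxBest inv′ reached (src≡ , Hg , tgt≡) = consequence
          (λ { {σ′ = σ′} (searched inv″ reached′ , wr) →
               searched inv″ (reached′ ∘ reached) ,
               (λ _ → subst (Reached (distₛ σ′)) tgt≡ wr) , λ y Hy → reached′ (y Hy) })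
          (relax-runs inv′ (reached ver-reached) src≡ Hg)

      scan-runs : Invariant act d r h p s → Reached d ver →
                  Runs′ (scan ver) (withSearch σ₀ d r b h p s) (scanCost (length (A ver)))
                    λ _ σ′ → ∃ λ b′ → Searched act b′ d σ′ × Scanned (distₛ σ′) ver
      scan-runs inv ver-reached =
        read-bind (call (firstPass refl) λ { (unchanged , all) →
          call (secondPass refl all) λ { (unchanged , all′) →
            consequence -,_ (thirdPass inv ver-reached all′) } })

    -- The credit of an active vertex: its scan, the return that closes the round, and the next
    -- extraction. In `Progress` the pending extraction is prepaid separately, and the extra step is
    -- the return on an empty heap.
    vertexCost : Vertex → ℕ
    vertexCost v = scanCost (length (A v)) + suc extractCost

    data Progress : Store → ℕ → Set where
      progress : Invariant act d r h p s → (∀ {v} → act v ≡ false → Scanned d v) →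
                 extractCost + suc (weight vertexCost act) ≤ k →
                 Progress (withSearch σ₀ d r b h p s) k

    data Settled : Store → Set where
      settled : d x ≡ ⊤± → (∀ {v} → Reached d v → ∃ (Chain d r v)) → (∀ {v} → Reached d v → Scanned d v) →
                Settled (withSearch σ₀ d r b h p s)

    extract-invariant : Invariant act d r h p s → IsHeapIndex h′ p′ s′ → Queued p ver → ¬ Queued p′ ver →
                        (∀ {u} → ver ≢ u → (Queued p u → Queued p′ u) × (Queued p′ u → Queued p u)) →
                        Invariant (override Fin._≟_ act ver false) d r h′ p′ s′
    extract-invariant {act = act} {p = p} {p′ = p′} {ver = ver} inv ix q ¬q′ others = record
      { heapIndex        = ix
      ; rootTop          = rootTop
      ; chain            = chain
      ; queued⇒reached   = λ q′ → queued⇒reached (proj₂ (others (other q′)) q′)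
      ; queued⇒active    = λ q′ → trans
          (override-other Fin._≟_ act (other q′)) (queued⇒active (proj₂ (others (other q′)) q′))
      ; unreached⇒active = λ dv≡⊥ → trans
          (override-other Fin._≟_ act {i = ver} λ { refl → queued⇒reached q dv≡⊥ }) (unreached⇒active dv≡⊥)
      ; active⇒queued    = λ {v} → override-elim Fin._≟_ act ver v (λ a → a ≡ true → _ → Queued p′ v)
          (λ _ ()) λ ver≢v a reached → proj₁ (others ver≢v) (active⇒queued a reached)
      }
      where
      open Invariant inv
      other : ∀ {u} → Queued p′ u → ver ≢ u
      other q′ refl = ¬q′ q′

    iteration-runs : ∀ {σ k} → Progress σ k →
                     Runs (extractMax >>= afterExtract) σ k λ r σ′ k′ →
                       [ (λ _ → Progress σ′ k′) , (λ _ → Settled σ′) ]′ r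
    iteration-runs (progress {act} {d} {r} {h} {p} {s} {b = b} inv scanned le) =
      weaken le (call (extractMax-runs heapIndex) after)
      where
      open Invariant inv

      after : ∀ {u σ′} → Extracted (withSearch σ₀ d r b h p s) u σ′ →
              Runs (afterExtract u) σ′ (suc (weight vertexCost act)) λ r σ′ k′ →
                [ (λ _ → Progress σ′ k′) , (λ _ → Settled σ′) ]′ r
      -- A reached vertex that is still active would be queued; with an empty heap every reached
      -- vertex is thus inactive, hence scanned.
      after (none empty) = return-runs (settled rootTop chain λ {v} reached →
        scanned (Bool.¬-not λ a → empty v (active⇒queued a reached)))
      after (some {v} ix q ¬q′ others) =
        weaken budget
          (call (Scan.scan-runs v (extract-invariant inv ix q ¬q′ others) (queued⇒reached q))
            λ { (_ , searched inv′ reached , scanned-v) → return-runs (progress inv′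
                  (λ {u} → override-elim Fin._≟_ act v u (λ a → a ≡ false → _)
                    (λ { refl _ → scanned-v }) (λ _ inactive f∈ Hf → reached (scanned inactive f∈ Hf)))
                  ℕ.≤-refl) })
        where
        act′ = override Fin._≟_ act v false
        c = scanCost (length (A v))
        budget : c + suc (extractCost + suc (weight vertexCost act′)) ≤ suc (weight vertexCost act)
        budget = ℕ.≤-trans (ℕ.≤-reflexive (rearrange c extractCost (weight vertexCost act′)))
          (s≤s (weight-drop vertexCost v (queued⇒active q) (override-same Fin._≟_ act v)
            λ u → override-elim Fin._≟_ act v u (λ a → a ≡ true → act u ≡ true) (λ _ ()) (λ _ → id)))
          where
          rearrange : ∀ c e t → c + suc (e + suc t) ≡ suc ((c + suc e) + t)
          rearrange = solve-∀

    -- `scanCost` is affine in the length of the list and the lengths sum to at most `m`, which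
    -- gives a cost linear in `n` and `m` apart from the heap operations.
    total-vertexCost : total vertexCost ≤ n * (5 + extractCost) + m * (9 + relaxCost)
    total-vertexCost = begin
      total vertexCost
        ≤⟨ total-mono (λ v → ℕ.≤-reflexive (affine (length (A v)) extractCost insertCost)) ⟩
      total (λ v → 5 + extractCost + length (A v) * (9 + relaxCost))
        ≡⟨ total-affine (5 + extractCost) (9 + relaxCost) (length ∘ A) ⟩
      n * (5 + extractCost) + total (length ∘ A) * (9 + relaxCost)
        ≤⟨ ℕ.+-monoʳ-≤ (n * (5 + extractCost)) (ℕ.*-monoˡ-≤ (9 + relaxCost) total≤m) ⟩
      n * (5 + extractCost) + m * (9 + relaxCost) ∎
      where
      open ℕ.≤-Reasoning
      affine : ∀ l e i → 1 + ((l * 2 + 1) + ((l * 5 + 1) + (l * (2 + (5 + i)) + 1))) + suc e ≡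
                         5 + e + l * (9 + (5 + i))
      affine = solve-∀

    data Initialised (σ : Store) : Store → Set where
      initialised : ∀ {d p} → Initialised σ (record σ { distₛ = d ; posₛ = p })

    initialise-runs : ∀ {σ} →
      Runs′ (forEach vertices λ v → write dist v ⊥± >> write pos v 0) σ (n * 2 + 1)
        λ _ σ′ → Initialised σ σ′ × (∀ v → distₛ σ′ v ≡ ⊥± × posₛ σ′ v ≡ 0)
    initialise-runs {σ} =
      forAllFin-runs (Initialised σ) (λ v σ′ → distₛ σ′ v ≡ ⊥± × posₛ σ′ v ≡ 0)
        (λ { {v} (initialised {d} {p}) → write-bind (write-runs (initialised ,
          (override-same Fin._≟_ d v , override-same Fin._≟_ p v) ,
          λ {u} (d≡ , p≡) → override-elim Fin._≟_ d v u (_≡ ⊥±) (λ _ → refl) (λ _ → d≡) ,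
                            override-elim Fin._≟_ p v u (_≡ 0) (λ _ → refl) (λ _ → p≡))) })
        initialised

    computeDist-runs : Runs′ (computeDist x) σ₀ searchCost λ _ σ′ → Settled σ′
    computeDist-runs = call initialise-runs λ { (initialised {d} {p} , zeros) →
      let p≡0 = proj₂ ∘ zeros
          d₁ = override Fin._≟_ d x ⊤±
          unqueued : ∀ {v} → ¬ Queued p v
          unqueued {v} q = case subst (1 ≤_) (p≡0 v) q of λ ()
          only-root : ∀ {v} → Reached d₁ v → x ≡ v
          only-root {v} = override-elim Fin._≟_ d x v (λ z → z ≢ ⊥± → x ≡ v)
            (λ x≡v _ → x≡v) (λ _ reached → contradiction (proj₁ (zeros v)) reached)
          root-top = override-same Fin._≟_ d x
          root-reached : Reached d₁ x
          root-reached eq = case trans (sym root-top) eq of λ ()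
          empty : IsHeapIndex (heapₛ σ₀) p 0
          empty = record
            { pos-heap = λ { (s≤s _) () }
            ; heap-pos = λ q → contradiction q unqueued
            ; pos≤size = λ v → ℕ.≤-reflexive (p≡0 v) }
      in write-bind (write-bind (call (insert-runs empty (p≡0 x)) λ { (inserted ix xq _ ⇒queued) →
           let only-x = λ {u} q → case ⇒queued {u} q of λ
                 { (inj₁ x≡u) → x≡u ; (inj₂ q′) → contradiction q′ unqueued }
           in loop-runs (λ _ → Progress) iteration-runs (progress {act = λ _ → true}
             (record
               { heapIndex        = ix
               ; rootTop          = root-top
               ; chain            = λ reached → 0 , subst (λ v → Chain _ _ v 0) (only-root reached) root
               ; queued⇒reached   = λ q → subst (Reached d₁) (only-x q) root-reached
               ; queued⇒active    = λ _ → refl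
               ; unreached⇒active = λ _ → refl
               ; active⇒queued    = λ _ reached → subst (Queued _) (only-root reached) xq
               })
             (λ ())
             (ℕ.+-monoʳ-≤ extractCost (s≤s (ℕ.≤-trans (weight≤total vertexCost _) total-vertexCost)))) })) }

    -- Recovering a path from the parent edges

    back : (Vertex → Edge) → Vertex → ℕ → Vertex
    back r v zero    = v
    back r v (suc i) = back r (src (r v)) i

    chain-back : ∀ {i} → Chain d r v k → i ≤ k → Chain d r (back r v i) (k ∸ i)
    chain-back c z≤n = c
    chain-back (link _ refl _ _ c) (s≤s i≤k) = chain-back c i≤k

    -- The parent array determines each link, and `v ≢ x` in `link` forces a chain to stop at its
    -- first visit to `x`.
    chain-length-unique : ∀ {j} → Chain d r v k → Chain d r v j → k ≡ j
    chain-length-unique root root = refl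
    chain-length-unique root (link x≢x _ _ _ _) = contradiction refl x≢x
    chain-length-unique (link x≢x _ _ _ _) root = contradiction refl x≢x
    chain-length-unique (link _ refl _ _ c) (link _ refl _ _ c′) = cong suc (chain-length-unique c c′)

    -- A repeated vertex would have two chains of different lengths.
    chain-length<n : Chain d r v k → k < n
    chain-length<n {d = d} {r = r} {v = v} {k = k} c =
      Fin.injective⇒≤ {f = λ (i : Fin (suc k)) → back r v (toℕ i)} λ {i} {j} eq →
        Fin.toℕ-injective (ℕ.∸-cancelˡ-≡ (bound i) (bound j)
          (chain-length-unique (chain-back c (bound i))
            (subst (λ u → Chain d r u _) (sym eq) (chain-back c (bound j)))))
      where
      bound : (i : Fin (suc k)) → toℕ i ≤ k
      bound i = ℕ.≤-pred (Fin.toℕ<n i)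

    AllInH : Path → Set
    AllInH P = All (λ f → H f ≡ true) (toList P)

    -- Induction on the chain, whose constructors decide the test of the loop: two steps for each
    -- link and one for the final return.
    recoverLoop-runs : ∀ {u e es} → Chain d r u k → src e ≡ u → AllInH (e ∷ es) →
                       Runs′ (loop (extendBack x) (e ∷ es)) (withSearch σ₀ d r b h p s) (k * 2 + 1)
                         λ P σ′ → σ′ ≡ withSearch σ₀ d r b h p s × AllInH P ×
                                  length (toList P) ≡ k + suc (length es)
    recoverLoop-runs {d = d} {r} {b = b} {h} {p} {s} {e = e} {es} root src≡ all =
      loop-unfold
        {Q = λ z σ′ _ → [ (λ _ → ⊥) , (λ P → σ′ ≡ σ × AllInH P × length (toList P) ≡ suc (length es)) ]′ z}
        (if-runs (src e Fin.≟ x) (λ _ → return-runs (refl , all , refl)) λ src≢ → contradiction src≡ src≢)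
        ⊥-elim id
      where
      σ = withSearch σ₀ d r b h p s
    recoverLoop-runs {d = d} {r} {b = b} {h} {p} {s} {e = e} {es} (link {k = k} u≢x refl Hf _ c) refl all =
      loop-unfold
        {Q = λ z σ′ k′ → [ (λ P → σ′ ≡ σ × P ≡ r (src e) ∷ e ∷ es × k′ ≡ k * 2 + 1) , (λ _ → ⊥) ]′ z}
        (if-runs (src e Fin.≟ x) (λ src≡ → contradiction src≡ u≢x)
          λ _ → read-bind (return-runs (refl , refl , refl)))
        (λ { (refl , refl , refl) → consequence
               (λ (σ≡ , all′ , len) → σ≡ , all′ , trans len (ℕ.+-suc k (suc (length es))))
               (recoverLoop-runs c refl (Hf ∷ all)) })
        ⊥-elim
      where
      σ = withSearch σ₀ d r b h p s

    data MaxflowResult (y : Vertex) : Maybe Path → Store → Set where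
      noPath : ¬ Walk H x y → MaxflowResult y nothing (withSearch σ₀ d r b h p s)
      path   : ∀ {P} → AllInH P → length (toList P) ≤ n → MaxflowResult y (just P) (withSearch σ₀ d r b h p s)

    walk-reached : (∀ {v} → Reached d v → Scanned d v) → ∀ {u v} → Walk H u v → Reached d u → Reached d v
    walk-reached closed ε reached = reached
    walk-reached closed ((f , Hf , refl , refl) ◅ walk) reached =
      walk-reached closed walk (closed reached (listed Hf) Hf)

    pathIfReached-runs : ∀ {y} → y ≢ x → d x ≡ ⊤± →
                         (∀ {v} → Reached d v → ∃ (Chain d r v)) → (∀ {v} → Reached d v → Scanned d v) →
                         ∀ z → z ≡ d y →
                         Runs′ (pathIfReached x y z) (withSearch σ₀ d r b h p s) (1 + ((n * 2 + 1) + 1))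
                           (MaxflowResult y)
    pathIfReached-runs {d} {r} {b} {h} {p} {s} {y} y≢x root-top chain closed = λ
      { ⊥±    ⊥≡ → return-runs (noPath λ walk →
          walk-reached closed walk (λ eq → case trans (sym root-top) eq of λ ()) (sym ⊥≡))
      ; [ _ ] z≡ → recovered (proj₂ (chain λ eq → case trans z≡ eq of λ ()))
      ; ⊤±    z≡ → recovered (proj₂ (chain λ eq → case trans z≡ eq of λ ()))
      }
      where
      recovered : ∀ {k} → Chain d r y k →
                  Runs′ (recoverPath x y >>= λ P → return (just P)) (withSearch σ₀ d r b h p s)
                    (1 + ((n * 2 + 1) + 1)) (MaxflowResult y)
      recovered root = contradiction refl y≢x
      recovered c@(link {k = k} _ refl Hf _ c′) =
        call {c = 1 + (n * 2 + 1)}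
          (read-bind (weaken (ℕ.+-monoˡ-≤ 1 (ℕ.*-monoˡ-≤ 2 (ℕ.≤-trans (ℕ.n≤1+n k) 1+k≤n)))
            (recoverLoop-runs c′ refl (Hf ∷ []))))
          λ { (refl , all , len) → return-runs (path all
                (ℕ.≤-trans (ℕ.≤-reflexive (trans len (ℕ.+-comm k 1))) 1+k≤n)) }
        where
        1+k≤n : suc k ≤ n
        1+k≤n = ℕ.<⇒≤ (chain-length<n c)

    maxflowPath-runs : ∀ {y} → y ≢ x → Runs′ (maxflowPath x y) σ₀ maxflowCost (MaxflowResult y)
    maxflowPath-runs y≢x = call computeDist-runs λ { (settled root-top chain closed) →
      read-bind (pathIfReached-runs y≢x root-top chain closed _ refl) }

-- The cost and progress of DELETE_CYCLE

module CycleCancellation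
  (V : OrderedAbelianGroup) {n m : ℕ} (G : WeightedMultidigraph V n m)
  (D : ℕ) (n<2^D : n < 2 ^ D) where

  open WeightedCycleDeletion V G
  open ProgramLogic V G
  open Walks V G
  open PathSearch V G D n<2^D
  open Store

  private
    module Order = IsDecTotalOrder (OrderedAbelianGroup.isDecTotalOrder V)
    open OrderedAbelianGroup V using (_≈_) renaming (_≤_ to _≤ᵥ_)

    -‿self : ∀ x → x - x ≈ 0#
    -‿self = IsAbelianGroup.inverseʳ (OrderedAbelianGroup.isAbelianGroup V)

  module _ {σ : Store} (P : Value → Set) where
    private
      choose : ∀ {x y} {Z : Set} (d : Dec Z) → P x → P y → P (if does d then x else y)
      choose (yes _) Px Py = Px
      choose (no _)  Px Py = Py

    -- The result is one of the Values compared, so a predicate true of all of them passes to it.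
    -- With `ValueOn` as predicate this yields an edge that attains the Value.
    maxFrom-runs : ∀ es {x} → P x → (∀ {f} → f ∈ es → P (valₛ σ f)) →
                   Runs′ (maxFrom x es) σ (suc (length es)) λ y σ′ → σ′ ≡ σ × P y
    maxFrom-runs []       Px Pes = return-runs (refl , Px)
    maxFrom-runs (e ∷ es) {x} Px Pes =
      read-bind (maxFrom-runs es (choose (x ≤? valₛ σ e) (Pes (here refl)) Px) (Pes ∘ there))

    minFrom-runs : ∀ es {x} → P x → (∀ {f} → f ∈ es → P (valₛ σ f)) →
                   Runs′ (minFrom x es) σ (suc (length es)) λ y σ′ → σ′ ≡ σ × P y
    minFrom-runs []       Px Pes = return-runs (refl , Px)
    minFrom-runs (e ∷ es) {x} Px Pes =
      read-bind (minFrom-runs es (choose (x ≤? valₛ σ e) Px (Pes (here refl))) (Pes ∘ there))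

  ValueOn : Store → List⁺ Edge → Value → Set
  ValueOn σ C x = ∃ λ f → f ∈ toList C × x ≡ valₛ σ f

  maxValue-runs : ∀ C {σ} → Runs′ (maxValue C) σ (suc (length (toList C))) λ x σ′ → σ′ ≡ σ × ValueOn σ C x
  maxValue-runs (e ∷ es) {σ} =
    read-bind (maxFrom-runs (ValueOn σ (e ∷ es)) es (e , here refl , refl) λ f∈ → _ , there f∈ , refl)

  minValue-runs : ∀ C {σ} → Runs′ (minValue C) σ (suc (length (toList C))) λ x σ′ → σ′ ≡ σ × ValueOn σ C x
  minValue-runs (e ∷ es) {σ} =
    read-bind (minFrom-runs (ValueOn σ (e ∷ es)) es (e , here refl , refl) λ f∈ → _ , there f∈ , refl)

  removeFromH-runs : ∀ {x σ} → Runs′ (removeFromH x) σ (m * 2 + 1) λ _ σ′ → ∃ λ H →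
                     σ′ ≡ record σ { inHₛ = H } × (∀ f → H f ≡ true → inHₛ σ f ≡ true) ×
                     (∀ f → x ≤ᵥ valₛ σ f → H f ≡ false)
  removeFromH-runs {x} {σ} = consequence (λ { ((H , refl , sub) , all) → H , refl , sub , all })
    (forAllFin-runs
      (λ σ′ → ∃ λ H → σ′ ≡ record σ { inHₛ = H } × (∀ f → H f ≡ true → inHₛ σ f ≡ true))
      (λ f σ′ → x ≤ᵥ valₛ σ f → inHₛ σ′ f ≡ false)
      (λ { {g} (H , refl , sub) → read-bind (if-runs (x ≤? valₛ σ g)
        (λ _ → write-runs
          ((_ , refl , λ f → override-elim Fin._≟_ H g f (λ z → z ≡ true → _) (λ _ ()) λ _ → sub f) ,
          (λ _ → override-same Fin._≟_ H g) ,
          λ {f} removed le → override-elim Fin._≟_ H g f (_≡ false) (λ _ → refl) λ _ → removed le))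
        λ x≰ → return-runs ((H , refl , sub) , (λ x≤ → contradiction x≤ x≰) , id)) })
      (_ , refl , λ _ → id))

  -- Paths have at most `n` edges and the cycles `suc n`; at most `m` paths are found, and the
  -- search that fails at the end makes `suc m` searches.
  collectIterationCost flowCost cancelCost deleteCost : ℕ
  collectIterationCost = maxflowCost + (suc n + ((m * 2 + 1) + 1))
  flowCost             = (2 + n) + ((2 + n) + 1)
  cancelCost           = flowCost + ((m * flowCost + 1) + ((2 + n) + (suc n * 3 + 1)))
  deleteCost           = (m * 2 + 1) + (suc m * collectIterationCost + cancelCost)

  record ShortPathIn (E : Edge → Bool) (P : Path) : Set where
    constructor shortPath
    field
      inside : All (λ f → E f ≡ true) (toList P)
      short  : length (toList P) ≤ n

  module Collect (σ : Store) (adjacency : AdjacencyFor (inGₛ σ) (adjₛ σ)) (x y : Vertex) (y≢x : y ≢ x) where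
    E : Edge → Bool
    E = inGₛ σ

    -- Each path added to `S` takes an edge out of H, so `length S + count H` does not grow. The
    -- walk is demanded only while `S` is empty: it makes the first search succeed.
    data Collecting (S : List Path) : Store → ℕ → Set where
      collecting : ∀ {H d r b h p s k} → H ⊆ᵉ E → (S ≡ [] → Walk H x y) → All (ShortPathIn E) S →
                   length S + count H ≤ m → suc (count H) * collectIterationCost ≤ k →
                   Collecting S (withSearch (record σ { inHₛ = H }) d r b h p s) k

    data Collected : List Path → Store → Set where
      collected : ∀ {P Ps H d r b h p s} → All (ShortPathIn E) (P ∷ Ps) → length (P ∷ Ps) ≤ m →
                  Collected (P ∷ Ps) (withSearch (record σ { inHₛ = H }) d r b h p s)

    iteration-runs : ∀ {S σ′ k} → Collecting S σ′ k →
                     Runs (maxflowPath x y >>= afterPath S) σ′ k λ z σ″ k′ →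
                       [ (λ S′ → Collecting S′ σ″ k′) , (λ S′ → Collected S′ σ″) ]′ z
    iteration-runs {S} (collecting {H} {d} {r} {b} {h} {p} {s} sub nonempty paths len le) =
      weaken (ℕ.≤-trans (ℕ.≤-reflexive (sym (ℕ.+-assoc maxflowCost _ _))) le)
        (call (maxflowPath-runs y≢x) after)
      where
      σ₁ = withSearch (record σ { inHₛ = H }) d r b h p s
      open Searching σ₁ (adjacency-⊆ sub adjacency) x using (MaxflowResult; noPath; path; maxflowPath-runs)

      after : ∀ {z σ′} → MaxflowResult y z σ′ →
              Runs (afterPath S z) σ′ ((suc n + ((m * 2 + 1) + 1)) + count H * collectIterationCost) λ z σ″ k′ →
                [ (λ S′ → Collecting S′ σ″ k′) , (λ S′ → Collected S′ σ″) ]′ z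
      after (noPath ¬walk) = return-runs (found S nonempty paths len)
        where
        found : ∀ S → (S ≡ [] → Walk H x y) → All (ShortPathIn E) S → length S + count H ≤ m →
                ∀ {d r b h p s} → Collected S (withSearch (record σ { inHₛ = H }) d r b h p s)
        found []       nonempty _     _   = contradiction (nonempty refl) ¬walk
        found (P ∷ Ps) nonempty paths len = collected paths (ℕ.m+n≤o⇒m≤o _ len)
      after (path {P = P} inside short) =
        weaken (ℕ.≤-reflexive (sym (rearrange n (m * 2 + 1) (count H * collectIterationCost))))
          (call (weaken (s≤s short) (maxValue-runs P)) λ { (refl , f , f∈ , refl) →
            call removeFromH-runs λ { (H′ , refl , sub′ , removed) →
              let drop = weight-drop (λ _ → 1) f (All.lookup inside f∈) (removed f Order.refl) sub′ in
              return-runs (collecting {H = H′} (λ g → sub g ∘ sub′ g) (λ ())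
                (shortPath (All.map (sub _) inside) short ∷ paths)
                (ℕ.≤-trans (ℕ.≤-reflexive (sym (ℕ.+-suc (length S) (count H′))))
                  (ℕ.≤-trans (ℕ.+-monoʳ-≤ (length S) drop) len))
                (ℕ.*-monoˡ-≤ collectIterationCost drop)) } })
        where
        rearrange : ∀ a b t → (suc a + (b + 1)) + t ≡ suc a + (b + suc t)
        rearrange = solve-∀

    collectPaths-runs : ∀ {H} → H ⊆ᵉ E → Walk H x y →
                        Runs′ (collectPaths x y) (record σ { inHₛ = H })
                          (suc m * collectIterationCost) Collected
    collectPaths-runs {H} sub walk = loop-runs Collecting iteration-runs
      (collecting sub (λ _ → walk) [] (count≤n H) (ℕ.*-monoˡ-≤ collectIterationCost (s≤s (count≤n H))))

  flowValue-runs : ∀ C {σ} → length (toList C) ≤ suc n → Runs′ (flowValue C) σ flowCost λ _ σ′ → σ′ ≡ σ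
  flowValue-runs C short =
    call (weaken (s≤s short) (maxValue-runs C)) λ { (refl , _) →
      call (weaken (s≤s short) (minValue-runs C)) λ { (refl , _) → return-runs refl } }

  minimizer-runs : ∀ {e P x E σ} Ps → All (ShortPathIn E) (P ∷ Ps) →
                   Runs′ (minimizer e P x Ps) σ (length Ps * flowCost + 1) λ Q σ′ → σ′ ≡ σ × ShortPathIn E Q
  minimizer-runs []       (P-ok ∷ [])           = return-runs (refl , P-ok)
  minimizer-runs {e} {P} {x} (Q ∷ Qs) (P-ok ∷ Q-ok ∷ Qs-ok) =
    weaken (ℕ.≤-reflexive (sym (ℕ.+-assoc flowCost (length Qs * flowCost) 1)))
      (call (flowValue-runs (e ∷⁺ Q) (s≤s (ShortPathIn.short Q-ok))) λ { {y} refl →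
        if-runs (x ≤? y) (λ _ → minimizer-runs Qs (P-ok ∷ Qs-ok)) λ _ → minimizer-runs Qs (Q-ok ∷ Qs-ok) })

  data Reduced (σ : Store) : Store → Set where
    reduced : ∀ {E′ v′} f → E′ ⊆ᵉ inGₛ σ → inGₛ σ f ≡ true → E′ f ≡ false →
              Reduced σ (record σ { inGₛ = E′ ; valₛ = v′ })

  subtractAlong-runs : ∀ {C σ} → All (λ f → inGₛ σ f ≡ true) (toList C) → length (toList C) ≤ suc n →
                       Runs′ (subtractAlong C) σ ((2 + n) + (suc n * 3 + 1)) λ _ σ′ → Reduced σ σ′
  subtractAlong-runs {C} {σ} inside short =
    call (weaken (s≤s short) (minValue-runs C)) λ { (refl , f , f∈ , refl) →
      weaken (ℕ.+-monoˡ-≤ 1 (ℕ.*-monoˡ-≤ 3 short))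
        (consequence (λ { ((E′ , v′ , refl , sub , _) , removed , _) →
                          reduced f sub (All.lookup inside f∈) (removed f∈ refl) })
          (forEach-runs (Subtracting f) (Removed f) (toList C) (λ {g} _ → step {f} {g})
            (_ , _ , refl , (λ _ → id) , inj₁ refl))) }
    where
    -- f is the edge whose Value c is subtracted; it leaves G' when it is first treated.
    Subtracting : Edge → Store → Set
    Subtracting f σ′ = ∃₂ λ E′ v′ → σ′ ≡ record σ { inGₛ = E′ ; valₛ = v′ } × E′ ⊆ᵉ inGₛ σ ×
                       (v′ f ≡ valₛ σ f ⊎ E′ f ≡ false)

    -- An implication, to fit the predicate on entries in `forEach-runs`; it is applied at the entry
    -- `f` of `C`.
    Removed : Edge → Edge → Store → Set
    Removed f g σ′ = g ≡ f → inGₛ σ′ f ≡ false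

    step : ∀ {f g σ′} → Subtracting f σ′ → Runs′ _ σ′ 3 λ _ σ″ →
           Subtracting f σ″ × Removed f g σ″ × (∀ {g′} → Removed f g′ σ′ → Removed f g′ σ″)
    step {f} {g} (E′ , v′ , refl , sub , before) =
      read-bind (write-bind (if-runs (y ≟ 0#)
        (λ _ → write-runs
          ((_ , _ , refl ,
            (λ f′ → override-elim Fin._≟_ E′ g f′ (λ z → z ≡ true → _) (λ _ ()) (λ _ → sub f′)) ,
            (case g Fin.≟ f of λ
              { (yes refl) → inj₂ (override-same Fin._≟_ E′ g)
              ; (no g≢f)   → [ (λ eq → inj₁ (trans (override-other Fin._≟_ v′ g≢f) eq))
                             , (λ eq → inj₂ (trans (override-other Fin._≟_ E′ g≢f) eq)) ]′ before })) ,
           (λ { refl → override-same Fin._≟_ E′ g }) ,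
           λ removed g′≡f → override-elim Fin._≟_ E′ g f (_≡ false) (λ _ → refl) λ _ → removed g′≡f))
        λ y≉0 → return-runs
          ((_ , _ , refl , sub ,
            (case g Fin.≟ f of λ
              { (yes g≡f) → inj₂ (gone y≉0 g≡f)
              ; (no g≢f)  → [ (λ eq → inj₁ (trans (override-other Fin._≟_ v′ g≢f) eq)) , inj₂ ]′ before })) ,
           gone y≉0 , id)))
      where
      y = v′ g - valₛ σ f

      -- While `f` has its original Value the difference is `x - x`, and the test for zero succeeds.
      -- If the test fails at `f`, then `f` has left G' before, which covers repeated entries.
      gone : ¬ (y ≈ 0#) → g ≡ f → E′ f ≡ false
      gone y≉0 refl =
        [ (λ eq → contradiction (subst (λ z → z - valₛ σ f ≈ 0#) (sym eq) (-‿self (valₛ σ f))) y≉0)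
        , id ]′ before

  cancelBest-runs : ∀ {e P Ps σ} → inGₛ σ e ≡ true →
                    All (ShortPathIn (inGₛ σ)) (P ∷ Ps) → length (P ∷ Ps) ≤ m →
                    Runs′ (cancelBest e (P ∷ Ps)) σ cancelCost λ _ σ′ → Reduced σ σ′
  cancelBest-runs {e} {P} {Ps} Ee (P-ok ∷ Ps-ok) len =
    call (flowValue-runs (e ∷⁺ P) (s≤s (ShortPathIn.short P-ok))) λ { refl →
      call (weaken (ℕ.+-monoˡ-≤ 1 (ℕ.*-monoˡ-≤ flowCost (ℕ.<⇒≤ len))) (minimizer-runs Ps (P-ok ∷ Ps-ok)))
        λ { (refl , shortPath inside short) → subtractAlong-runs (Ee ∷ inside) (s≤s short) } }

  data CycleDeleted (σ : Store) : Store → Set where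
    cycleDeleted : ∀ {E′ v′ H d r b h p s} f → E′ ⊆ᵉ inGₛ σ → inGₛ σ f ≡ true → E′ f ≡ false →
                   CycleDeleted σ (withSearch (record σ { inGₛ = E′ ; valₛ = v′ ; inHₛ = H }) d r b h p s)

  copyToH-runs : ∀ {σ} → Runs′ (forEach edges λ f → read inG f >>= write inH f) σ (m * 2 + 1)
                   λ _ σ′ → ∃ λ H → σ′ ≡ record σ { inHₛ = H } × (∀ f → H f ≡ inGₛ σ f)
  copyToH-runs {σ} = consequence (λ { ((H , refl) , copied) → H , refl , copied })
    (forAllFin-runs (λ σ′ → ∃ λ H → σ′ ≡ record σ { inHₛ = H }) (λ f σ′ → inHₛ σ′ f ≡ inGₛ σ f)
      (λ { {g} (H , refl) → read-bind (write-runs ((_ , refl) , override-same Fin._≟_ H g ,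
        λ {f} eq → override-elim Fin._≟_ H g f (_≡ inGₛ σ f) (λ { refl → refl }) λ _ → eq)) })
      (_ , refl))

  deleteCycle-runs : ∀ {e σ} → AdjacencyFor (inGₛ σ) (adjₛ σ) → inGₛ σ e ≡ true →
                     Walk (inGₛ σ) (tgt e) (src e) →
                     Runs′ (deleteCycle e) σ deleteCost λ _ σ′ → CycleDeleted σ σ′
  deleteCycle-runs {e} {σ} adjacency Ee walk =
    call copyToH-runs λ { (H , refl , copied) →
      call (collectPaths-runs (λ f Hf → trans (sym (copied f)) Hf)
             (Star.map (λ { (f , Ef , s , t) → f , trans (copied f) Ef , s , t }) walk))
        λ { (collected paths len) → consequence
              (λ { (reduced f sub Ef E′f) → cycleDeleted f sub Ef E′f })
              (cancelBest-runs Ee paths len) } }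
    where open Collect σ adjacency (tgt e) (src e) (loopless e)

-- Depth-first search: correctness and linear cost

module CycleDetection
  (V : OrderedAbelianGroup) {n m : ℕ} (G : WeightedMultidigraph V n m) where

  open WeightedCycleDeletion V G
  open ProgramLogic V G
  open Walks V G
  open Store

  isWhite : Colour → Bool
  isWhite white = true
  isWhite grey  = false
  isWhite black = false

  -- 2 pays for blackening a vertex and returning. 5 pays for the dearest outcome of an edge, a
  -- discovery: the reads of `inG` and `colour`, the write of `grey`, the read of `adj` and a
  -- return.
  stackCost : Stack → ℕ
  stackCost []             = 0
  stackCost ((_ , es) ∷ st) = (2 + length es * 5) + stackCost st

  OnStack : Vertex → Stack → Set
  OnStack v = Any (λ entry → proj₁ entry ≡ v)

  detectCost : ℕ
  detectCost = (n * 1 + 1) + (n * 4 + ((n * 2 + m * 5) + 1))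

  module DepthFirst (σ : Store) (adjacency : AdjacencyFor (inGₛ σ) (adjₛ σ)) where
    open AdjacencyFor adjacency

    E : Edge → Bool
    E = inGₛ σ

    A : Vertex → List Edge
    A = adjₛ σ

    withColour : (Vertex → Colour) → Store
    withColour c = record σ { colourₛ = c }

    private variable
      c c′ : Vertex → Colour
      a : Maybe Vertex
      st : Stack
      v w : Vertex
      es : List Edge

    -- Accessibility for the edge relation: no infinite walk starts at `v`. It expresses that a
    -- black vertex is finished without recording an order of finishing.
    data Ends : Vertex → Set where
      ends : (∀ {f} → E f ≡ true → src f ≡ v → Ends (tgt f)) → Ends v

    -- Induction on `Ends`: moving the first edge of the closed walk to its end gives a closed walk
    -- based one step further on.
    ends-noReturn : ∀ {f} → Ends v → E f ≡ true → src f ≡ v → ¬ Walk E (tgt f) v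
    ends-noReturn (ends next) Ef src≡v ε = ends-noReturn (next Ef src≡v) Ef src≡v ε
    ends-noReturn {f = f} (ends next) Ef src≡v ((g , Eg , srcg , refl) ◅ walk) =
      ends-noReturn (next Ef src≡v) Eg srcg (walk ◅◅ (f , Ef , src≡v , refl) ◅ ε)

    vertexCost : Vertex → ℕ
    vertexCost v = 2 + length (A v) * 5

    whiteCost : (Vertex → Colour) → ℕ
    whiteCost c = weight vertexCost (isWhite ∘ c)

    whiteCost-≤ : whiteCost c ≤ n * 2 + m * 5
    whiteCost-≤ {c} = begin
      whiteCost c                        ≤⟨ weight≤total vertexCost (isWhite ∘ c) ⟩
      total vertexCost                   ≡⟨ total-affine 2 5 (length ∘ A) ⟩
      n * 2 + total (length ∘ A) * 5     ≤⟨ ℕ.+-monoʳ-≤ (n * 2) (ℕ.*-monoˡ-≤ 5 total≤m) ⟩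
      n * 2 + m * 5                      ∎
      where open ℕ.≤-Reasoning

    blacken-whiteCost : ∀ c v → whiteCost (override Fin._≟_ c v black) ≤ whiteCost c
    blacken-whiteCost c v = weight-mono vertexCost λ u →
      override-elim Fin._≟_ c v u (λ z → isWhite z ≡ true → isWhite (c u) ≡ true) (λ _ ()) (λ _ → id)

    discover-whiteCost : ∀ c w → c w ≡ white →
                         vertexCost w + whiteCost (override Fin._≟_ c w grey) ≤ whiteCost c
    discover-whiteCost c w cw≡white = weight-drop vertexCost w (cong isWhite cw≡white)
      (cong isWhite (override-same Fin._≟_ c w)) λ u →
        override-elim Fin._≟_ c w u (λ z → isWhite z ≡ true → isWhite (c u) ≡ true) (λ _ ()) (λ _ → id)

    -- a is the vertex above v on the stack.
    record FrameOK (c : Vertex → Colour) (a : Maybe Vertex) (v : Vertex) (es : List Edge) : Set where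
      field
        sources  : ∀ {f} → f ∈ es → src f ≡ v
        explored : ∀ {f} → E f ≡ true → src f ≡ v → f ∈ es ⊎ c (tgt f) ≡ black ⊎ a ≡ just (tgt f)
        linked   : ∀ {u} → a ≡ just u → Step E v u

    fresh-frame : FrameOK c nothing v (A v)
    fresh-frame = record
      { sources  = source
      ; explored = λ {f} Ef src≡v → inj₁ (subst (λ u → f ∈ A u) src≡v (listed Ef))
      ; linked   = λ ()
      }

    data StackOK (c : Vertex → Colour) : Maybe Vertex → Stack → Set where
      []  : StackOK c a []
      _∷_ : FrameOK c a v es → StackOK c (just v) st → StackOK c a ((v , es) ∷ st)

    _⊆ᵇ_ : (c c′ : Vertex → Colour) → Set
    c ⊆ᵇ c′ = ∀ {v} → c v ≡ black → c′ v ≡ black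

    stack-mono : c ⊆ᵇ c′ → StackOK c a st → StackOK c′ a st
    stack-mono sub []           = []
    stack-mono sub (frame ∷ ok) = record
      { sources  = sources
      ; explored = λ Ef src≡ → case explored Ef src≡ of λ
          { (inj₁ f∈) → inj₁ f∈
          ; (inj₂ (inj₁ bl)) → inj₂ (inj₁ (sub bl))
          ; (inj₂ (inj₂ eq)) → inj₂ (inj₂ eq) }
      ; linked   = linked
      } ∷ stack-mono sub ok
      where open FrameOK frame

    -- The edge from the new top vertex to the popped one was excused as leading up the stack; now
    -- its head is black.
    pop-stack : c v ≡ black → StackOK c (just v) st → StackOK c nothing st
    pop-stack cv≡black []           = []
    pop-stack cv≡black (frame ∷ ok) = record
      { sources  = sources
      ; explored = λ Ef src≡ → case explored Ef src≡ of λ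
          { (inj₁ f∈) → inj₁ f∈
          ; (inj₂ (inj₁ bl)) → inj₂ (inj₁ bl)
          ; (inj₂ (inj₂ refl)) → inj₂ (inj₁ cv≡black) }
      ; linked   = λ ()
      } ∷ ok
      where open FrameOK frame

    stack-walk : StackOK c (just v) st → OnStack w st → Walk E w v
    stack-walk (frame ∷ ok) (here refl) = FrameOK.linked frame refl ◅ ε
    stack-walk (frame ∷ ok) (there on)  = stack-walk ok on ◅◅ FrameOK.linked frame refl ◅ ε

    blacken-⊆ᵇ : ∀ c w → c ⊆ᵇ override Fin._≟_ c w black
    blacken-⊆ᵇ c w {v} bl = override-elim Fin._≟_ c w v (_≡ black) (λ _ → refl) λ _ → bl

    discover-⊆ᵇ : ∀ c w → c w ≡ white → c ⊆ᵇ override Fin._≟_ c w grey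
    discover-⊆ᵇ c w cw≡white bl =
      trans (override-other Fin._≟_ c {i = w} λ { refl → case trans (sym cw≡white) bl of λ () }) bl

    record ColouringOK (c : Vertex → Colour) (st : Stack) : Set where
      field
        black⇒ends    : c v ≡ black → Ends v
        grey⇒onStack  : c v ≡ grey → OnStack v st

    discover-colouring : c w ≡ white → ColouringOK c st →
                         ColouringOK (override Fin._≟_ c w grey) ((w , es) ∷ st)
    discover-colouring {c} {w} {st} {es} cw≡white ok = record
      { black⇒ends   = λ {v} → override-elim Fin._≟_ c w v (λ z → z ≡ black → Ends v) (λ _ ()) λ _ → black⇒ends
      ; grey⇒onStack = λ {v} → override-elim Fin._≟_ c w v (λ z → z ≡ grey → OnStack v ((w , es) ∷ st))
                         (λ w≡v _ → here w≡v) (λ _ g → there (grey⇒onStack g))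
      }
      where open ColouringOK ok

    -- N is a set of vertices known not to be white and k₀ a budget kept for later.
    module _ (N : Vertex → Set) (k₀ : ℕ) where

      data Exploring : Stack → Store → ℕ → Set where
        exploring : ∀ {k} → ColouringOK c st → StackOK c nothing st → (∀ {v} → N v → c v ≢ white) →
                    suc (stackCost st) + (whiteCost c + k₀) ≤ k → Exploring st (withColour c) k

      data Explored : Bool → Store → ℕ → Set where
        cyclic : ∀ {k} → Cycle E → k₀ ≤ k → Explored true (withColour c) k
        clear  : ∀ {k} → ColouringOK c [] → (∀ {v} → N v → c v ≢ white) → whiteCost c + k₀ ≤ k →
                 Explored false (withColour c) k

      Outcome : Stack ⊎ Bool → Store → ℕ → Set
      Outcome z σ′ k′ = [ (λ st → Exploring st σ′ k′) , (λ found → Explored found σ′ k′) ]′ z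

      dfsStep-runs : ∀ {st σ′ k} → Exploring st σ′ k → Runs (dfsStep st) σ′ k Outcome
      dfsStep-runs {[]} (exploring ok [] nonwhite le) = weaken le (return-runs (clear ok nonwhite ℕ.≤-refl))
      dfsStep-runs {(v , []) ∷ st} (exploring {c} ok (frame ∷ stack) nonwhite le) =
        weaken le (write-bind (return-runs (exploring
          (record
            { black⇒ends   = λ {u} → override-elim Fin._≟_ c v u (λ z → z ≡ black → Ends u)
                               (λ { refl _ → ends-v }) (λ _ → black⇒ends)
            ; grey⇒onStack = λ {u} → override-elim Fin._≟_ c v u (λ z → z ≡ grey → OnStack u st)
                               (λ _ ()) λ v≢u g → case grey⇒onStack g of λ
                                 { (here v≡u) → contradiction v≡u v≢u ; (there on) → on }
            })
          (pop-stack (override-same Fin._≟_ c v) (stack-mono (blacken-⊆ᵇ c v) stack))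
          (λ {u} Nu → override-elim Fin._≟_ c v u (_≢ white) (λ _ ()) λ _ → nonwhite Nu)
          (s≤s (ℕ.+-monoʳ-≤ (stackCost st) (ℕ.+-monoˡ-≤ k₀ (blacken-whiteCost c v)))))))
        where
        open ColouringOK ok
        -- No edge of the frame is pending and no vertex lies above it, so `explored` leaves only
        -- edges with black heads.
        ends-v : Ends v
        ends-v = ends λ Ef src≡ → case FrameOK.explored frame Ef src≡ of λ
          { (inj₂ (inj₁ bl)) → black⇒ends bl }
      dfsStep-runs {(v , e ∷ es) ∷ st} (exploring {c} ok (frame ∷ stack) nonwhite le) =
        weaken le (read-bind (if-bool-runs (E e)
          (λ Ee → read-bind (visited Ee (c (tgt e)) refl))
          λ Ee → return-runs (next 3 λ { refl Ee′ → case trans (sym Ee) Ee′ of λ () })))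
        where
        open FrameOK frame
        open ColouringOK ok
        rest = length es * 5 + stackCost st + (whiteCost c + k₀)

        explored′ : ∀ {a} → (∀ {f} → f ≡ e → E f ≡ true → c (tgt f) ≡ black ⊎ a ≡ just (tgt f)) →
                    ∀ {f} → E f ≡ true → src f ≡ v → f ∈ es ⊎ c (tgt f) ≡ black ⊎ a ≡ just (tgt f)
        explored′ done Ef src≡ = case explored Ef src≡ of λ
          { (inj₁ (here f≡e))   → inj₂ (done f≡e Ef)
          ; (inj₁ (there f∈))   → inj₁ f∈
          ; (inj₂ (inj₁ bl))    → inj₂ (inj₁ bl) }

        ok′ : ColouringOK c ((v , es) ∷ st)
        ok′ = record
          { black⇒ends   = black⇒ends
          ; grey⇒onStack = λ g → case grey⇒onStack g of λ { (here eq) → here eq ; (there on) → there on }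
          }

        next : ∀ k → (∀ {f} → f ≡ e → E f ≡ true → c (tgt f) ≡ black) →
               Exploring ((v , es) ∷ st) (withColour c) (3 + k + rest)
        next k done = exploring
          ok′
          (record { sources  = sources ∘ there
                  ; explored = explored′ (λ f≡e Ef → inj₁ (done f≡e Ef))
                  ; linked   = λ () } ∷ stack)
          nonwhite (s≤s (s≤s (s≤s (ℕ.m≤n+m rest k))))

        visited : E e ≡ true → ∀ z → z ≡ c (tgt e) →
                  Runs (visit (tgt e) ((v , es) ∷ st) z) (withColour c) (6 + rest) Outcome
        visited Ee black bl = return-runs (next 2 λ { refl _ → sym bl })
        -- A grey head lies on the stack, whose frames are joined by edges of G' from there up to
        -- `v`; the edge `e` closes the cycle.
        visited Ee grey  gr = return-runs (cyclic (cycle (grey⇒onStack (sym gr)))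
          (ℕ.≤-trans (ℕ.m≤n+m k₀ (whiteCost c))
            (ℕ.≤-trans (ℕ.m≤n+m _ (length es * 5 + stackCost st)) (ℕ.m≤n+m rest 5))))
          where
          cycle : ∀ {es} → OnStack (tgt e) ((v , es) ∷ st) → Cycle E
          cycle (here v≡)  = e , Ee , subst (λ u → Walk E u (src e)) (trans (sources (here refl)) v≡) ε
          cycle (there on) = e , Ee , subst (Walk E (tgt e)) (sym (sources (here refl))) (stack-walk stack on)
        visited Ee white wh = write-bind (read-bind (return-runs (exploring
          (discover-colouring (sym wh) ok′)
          (fresh-frame ∷
           stack-mono (discover-⊆ᵇ c (tgt e) (sym wh))
             (record { sources  = sources ∘ there
                     ; explored = explored′ (λ { refl _ → inj₂ refl })
                     ; linked   = λ { refl → e , Ee , sources (here refl) , refl } } ∷ stack))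
          (λ {u} Nu → override-elim Fin._≟_ c (tgt e) u (_≢ white) (λ _ ()) λ _ → nonwhite Nu)
          (ℕ.≤-trans (ℕ.≤-reflexive (rearrange (vertexCost (tgt e)) (length es * 5) (stackCost st) _ k₀))
            (s≤s (s≤s (s≤s (ℕ.+-monoʳ-≤ (length es * 5 + stackCost st)
              (ℕ.+-monoˡ-≤ k₀ (discover-whiteCost c (tgt e) (sym wh)))))))))))
          where
          rearrange : ∀ x l s w k → suc (x + ((2 + l) + s)) + (w + k) ≡ 3 + (l + s + ((x + w) + k))
          rearrange = solve-∀

    dfs-runs : ∀ (N : Vertex → Set) k₀ → c v ≡ white → ColouringOK c [] → (∀ {u} → N u → c u ≢ white) →
               Runs (dfs v) (withColour c) (3 + (whiteCost c + k₀)) (Explored (λ u → v ≡ u ⊎ N u) k₀)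
    dfs-runs {c} {v} N k₀ cv≡white ok nonwhite =
      write-bind (read-bind (loop-runs (Exploring N′ k₀) (dfsStep-runs N′ k₀) (exploring
        (discover-colouring cv≡white ok)
        (fresh-frame ∷ [])
        (λ {u} Nu → override-elim Fin._≟_ c v u (_≢ white) (λ _ ())
          λ v≢u → [ (λ v≡u → contradiction v≡u v≢u) , nonwhite ]′ Nu)
        (ℕ.≤-trans (ℕ.≤-reflexive (rearrange (vertexCost v) _ k₀))
          (s≤s (ℕ.+-monoˡ-≤ k₀ (discover-whiteCost c v cv≡white)))))))
      where
      N′ : Vertex → Set
      N′ u = v ≡ u ⊎ N u
      rearrange : ∀ x w k → suc (x + 0) + (w + k) ≡ suc ((x + w) + k)
      rearrange = solve-∀

    data Verdict : Bool → Store → Set where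
      cycleFound : Cycle E → Verdict true (withColour c)
      noCycle    : ¬ Cycle E → Verdict false (withColour c)

    -- At the end of the list no vertex is white, and none is grey as the stack is empty; all are
    -- black, so every vertex satisfies `Ends`. White vertices keep their credit from one root to
    -- the next.
    dfsFromAll-runs : ∀ vs → ColouringOK c [] → (∀ v → v ∈ vs ⊎ c v ≢ white) →
                      Runs′ (dfsFromAll vs) (withColour c) (length vs * 4 + (whiteCost c + 1)) Verdict
    dfsFromAll-runs {c} [] ok covered = weaken (ℕ.m≤n+m 1 (whiteCost c))
      (return-runs (noCycle λ (f , Ef , walk) → ends-noReturn (all-end (src f) (c (src f)) refl) Ef refl walk))
      where
      open ColouringOK ok
      all-end : ∀ v z → z ≡ c v → Ends v
      all-end v black bl = black⇒ends (sym bl)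
      all-end v grey  gr = case grey⇒onStack (sym gr) of λ ()
      all-end v white wh = case covered v of λ { (inj₂ nonwhite) → contradiction (sym wh) nonwhite }
    dfsFromAll-runs {c} (v ∷ vs) ok covered =
      read-bind (bind (attempt (c v) refl) λ
        { (cyclic cycle le) → weaken (ℕ.≤-trans (ℕ.m≤n+m 1 _) le) (return-runs (cycleFound cycle))
        ; (clear {c′} ok′ nonwhite le) →
            weaken (ℕ.≤-trans (ℕ.≤-reflexive (rearrange (length vs * 4) (whiteCost c′))) le)
              (dfsFromAll-runs vs ok′ λ u → case covered u of λ
                { (inj₁ (here refl)) → inj₂ (nonwhite (inj₁ refl))
                ; (inj₁ (there u∈))  → inj₁ u∈
                ; (inj₂ nw)          → inj₂ (nonwhite (inj₂ nw)) }) })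
      where
      N : Vertex → Set
      N u = c u ≢ white
      k₀ = length vs * 4 + 1

      rearrange : ∀ l w → l + (w + 1) ≡ w + (l + 1)
      rearrange = solve-∀

      enough : whiteCost c + k₀ ≤ length vs * 4 + (whiteCost c + 1)
      enough = ℕ.≤-reflexive (sym (rearrange (length vs * 4) (whiteCost c)))

      seen : c v ≢ white → Runs (return false) (withColour c) (3 + (length vs * 4 + (whiteCost c + 1)))
                             (Explored (λ u → v ≡ u ⊎ N u) k₀)
      seen nonwhite = return-runs (clear ok
        (λ { (inj₁ refl) → nonwhite ; (inj₂ nw) → nw }) (ℕ.≤-trans enough (ℕ.m≤n+m _ 2)))

      attempt : ∀ z → z ≡ c v →
                Runs (dfsIfWhite v z) (withColour c) (3 + (length vs * 4 + (whiteCost c + 1)))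
                  (Explored (λ u → v ≡ u ⊎ N u) k₀)
      attempt white wh = weaken (ℕ.+-monoʳ-≤ 3 enough) (dfs-runs N k₀ (sym wh) ok id)
      attempt grey  gr = seen λ wh → case trans gr wh of λ ()
      attempt black bl = seen λ wh → case trans bl wh of λ ()

    hasCycle-runs : Runs′ hasCycle σ detectCost Verdict
    hasCycle-runs =
      call (forAllFin-runs (λ σ′ → ∃ λ c → σ′ ≡ withColour c) (λ v σ′ → colourₛ σ′ v ≡ white)
             (λ { {v} (c , refl) → write-runs ((_ , refl) , override-same Fin._≟_ c v ,
               λ {u} eq → override-elim Fin._≟_ c v u (_≡ white) (λ _ → refl) λ _ → eq) })
             (_ , refl))
        λ { ((c , refl) , all-white) →
          weaken (ℕ.+-mono-≤ (ℕ.≤-reflexive (cong (_* 4) (length-tabulate {n = n} id))) (ℕ.+-monoˡ-≤ 1 whiteCost-≤))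
            (dfsFromAll-runs vertices
              (record { black⇒ends   = λ {v} eq → case trans (sym (all-white v)) eq of λ ()
                      ; grey⇒onStack = λ {v} eq → case trans (sym (all-white v)) eq of λ () })
              λ v → inj₁ (∈-allFin v)) }

-- Amortisation over all insertions

module MainLoop
  (V : OrderedAbelianGroup) {n m : ℕ} (G : WeightedMultidigraph V n m)
  (D : ℕ) (n<2^D : n < 2 ^ D) where

  open WeightedCycleDeletion V G
  open ProgramLogic V G
  open Walks V G
  open CycleCancellation V G D n<2^D
  open CycleDetection V G
  open PathSearch V G D n<2^D
  open Store

  -- `edgeCost` contains the 4 steps of the insertion, the `roundCost` deposited on the new edge,
  -- and the last detection with its return, which finds no cycle.
  roundCost edgeCost deletionCost : ℕ
  roundCost    = detectCost + (deleteCost + 1)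
  edgeCost     = 4 + (roundCost + (detectCost + 1))
  deletionCost = (n * 1 + 1) + ((m * 1 + 1) + (m * edgeCost + 1))

  module Clean (e : Edge) (A : Vertex → List Edge) (k₀ : ℕ) where

    -- The next detection is prepaid, and every edge of G' holds one round. Acyclicity apart from
    -- `e` survives because a deletion only removes edges. In `Cleaned` the deposits of the
    -- surviving edges are kept for later insertions.
    data Cleaning (σ : Store) (k : ℕ) : Set where
      cleaning : adjₛ σ ≡ A → AdjacencyFor (inGₛ σ) A → ¬ Cycle (inGₛ σ without e) →
                 detectCost + (count (inGₛ σ) * roundCost + suc k₀) ≤ k → Cleaning σ k

    data Cleaned (σ : Store) (k : ℕ) : Set where
      cleaned : adjₛ σ ≡ A → AdjacencyFor (inGₛ σ) A → ¬ Cycle (inGₛ σ) →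
                count (inGₛ σ) * roundCost + k₀ ≤ k → Cleaned σ k

    round-runs : ∀ {σ k} → Cleaning σ k →
                 Runs (hasCycle >>= deleteIfCycle e) σ k λ r σ′ k′ →
                   [ (λ _ → Cleaning σ′ k′) , (λ _ → Cleaned σ′ k′) ]′ r
    round-runs {σ} (cleaning refl adjacency acyclic le) = weaken le (call hasCycle-runs after)
      where
      open DepthFirst σ adjacency using (Verdict; cycleFound; noCycle; hasCycle-runs)
      c = count (inGₛ σ)

      after : ∀ {found σ′} → Verdict found σ′ →
              Runs (deleteIfCycle e found) σ′ (c * roundCost + suc k₀) λ r σ″ k′ →
                [ (λ _ → Cleaning σ″ k′) , (λ _ → Cleaned σ″ k′) ]′ r
      after (noCycle ¬cycle) =
        weaken (ℕ.≤-reflexive (sym (ℕ.+-suc (c * roundCost) k₀)))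
          (return-runs (cleaned refl adjacency ¬cycle ℕ.≤-refl))
      after (cycleFound cycle) =
        weaken budget (call (deleteCycle-runs adjacency Ee walk) λ { (cycleDeleted f sub Ef E′f) →
          let drop = weight-drop (λ _ → 1) f Ef E′f sub in
          return-runs (cleaning refl (adjacency-⊆ sub adjacency)
            (acyclic ∘ cycle-mono (without-mono {e = e} sub))
            (ℕ.+-monoʳ-≤ detectCost (ℕ.+-monoˡ-≤ (suc k₀) (ℕ.*-monoˡ-≤ roundCost
              (ℕ.≤-pred (ℕ.≤-trans drop (ℕ.≤-reflexive (sym suc-pred)))))))) })
        where
        through = cycle-through e acyclic cycle
        Ee = proj₁ through
        walk = proj₂ through

        suc-pred : suc (pred c) ≡ c
        suc-pred = ℕ.suc-pred c {{>-nonZero (count-positive e Ee)}}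

        rearrange : ∀ t x y k → (t + (x + 1) + y) + suc k ≡ x + suc (t + (y + suc k))
        rearrange = solve-∀

        budget : deleteCost + suc (detectCost + (pred c * roundCost + suc k₀)) ≤ c * roundCost + suc k₀
        budget = ℕ.≤-trans
          (ℕ.≤-reflexive (sym (rearrange detectCost deleteCost (pred c * roundCost) k₀)))
          (ℕ.≤-reflexive (cong (λ c → c * roundCost + suc k₀) suc-pred))

    clean-runs : ∀ {σ k} → Cleaning σ k →
                 Runs (loop (λ _ → hasCycle >>= deleteIfCycle e) tt) σ k λ _ → Cleaned
    clean-runs = loop-runs (λ _ → Cleaning) round-runs

  -- es are the edges still to be inserted.
  record Inserting (es : List Edge) (A : Vertex → List Edge) (E : Edge → Bool) : Set where
    field
      listed  : ∀ {f} → E f ≡ true → f ∈ A (src f)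
      source  : ∀ {v f} → f ∈ A v → src f ≡ v
      room    : total (length ∘ A) + length es ≤ m
      acyclic : ¬ Cycle E

  insert-listed : ∀ {A : Vertex → List Edge} {E e} → (∀ {f} → E f ≡ true → f ∈ A (src f)) →
                  ∀ {f} → override Fin._≟_ E e true f ≡ true →
                  f ∈ override Fin._≟_ A (src e) (e ∷ A (src e)) (src f)
  insert-listed {A} {E} {e} listed {f} = override-elim Fin._≟_ E e f
    (λ z → z ≡ true → f ∈ override Fin._≟_ A (src e) (e ∷ A (src e)) (src f))
    (λ { refl _ → subst (e ∈_) (sym (override-same Fin._≟_ A (src e))) (here refl) })
    λ _ Ef → override-elim Fin._≟_ A (src e) (src f) (f ∈_)
      (λ src≡ → there (subst (λ u → f ∈ A u) (sym src≡) (listed Ef))) λ _ → listed Ef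

  insert-source : ∀ {A : Vertex → List Edge} {e} → (∀ {v f} → f ∈ A v → src f ≡ v) →
                  ∀ {v f} → f ∈ override Fin._≟_ A (src e) (e ∷ A (src e)) v → src f ≡ v
  insert-source {A} {e} source {v} {f} = override-elim Fin._≟_ A (src e) v (λ l → f ∈ l → src f ≡ v)
    (λ { refl (here refl) → refl ; refl (there f∈) → source f∈ }) λ _ → source

  insert-total : ∀ {A : Vertex → List Edge} {e} →
                 total (length ∘ override Fin._≟_ A (src e) (e ∷ A (src e))) ≤ suc (total (length ∘ A))
  insert-total {A} {e} = total-change {c = 0} {d = 1} (src e)
    (λ v src≢v → ℕ.≤-reflexive (cong length (override-other Fin._≟_ A src≢v)))
    (ℕ.≤-reflexive (cong length (override-same Fin._≟_ A (src e))))

  insertAll-runs : ∀ es {σ} → Inserting es (adjₛ σ) (inGₛ σ) →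
                   Runs′ (forEach es λ e → insertEdge e >> loop (λ _ → hasCycle >>= deleteIfCycle e) tt) σ
                     (count (inGₛ σ) * roundCost + (length es * edgeCost + 1)) λ _ _ → ⊤
  insertAll-runs []       {σ} _ = weaken (ℕ.m≤n+m 1 (count (inGₛ σ) * roundCost)) (return-runs tt)
  insertAll-runs (e ∷ es) {σ} inserting =
    weaken budget (bind
      (call {c = 4} {P = λ _ σ′ → σ′ ≡ σ₁} (read-bind (write-bind (write-bind (write-runs refl))))
        λ { refl → clean-runs (cleaning refl adjacency₁ acyclic₁ ℕ.≤-refl) })
      λ { {σ′ = σ′} (cleaned adj≡ adjacency acyclic′ le) →
          weaken le (insertAll-runs es
            (subst (λ A → Inserting es A (inGₛ σ′)) (sym adj≡) (record
              { listed  = AdjacencyFor.listed adjacency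
              ; source  = AdjacencyFor.source adjacency
              ; room    = room₁
              ; acyclic = acyclic′
              }))) })
    where
    open Inserting inserting
    A = adjₛ σ
    E = inGₛ σ
    A₁ = override Fin._≟_ A (src e) (e ∷ A (src e))
    E₁ = override Fin._≟_ E e true
    σ₁ = record σ { adjₛ = A₁ ; valₛ = override Fin._≟_ (valₛ σ) e (value e) ; inGₛ = E₁ }
    k₀ = length es * edgeCost + 1
    open Clean e A₁ k₀

    room₁ : total (length ∘ A₁) + length es ≤ m
    room₁ = ℕ.≤-trans (ℕ.+-monoˡ-≤ (length es) (insert-total {A} {e}))
              (ℕ.≤-trans (ℕ.≤-reflexive (sym (ℕ.+-suc (total (length ∘ A)) (length es)))) room)

    adjacency₁ : AdjacencyFor E₁ A₁
    adjacency₁ = record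
      { listed  = insert-listed {A} {E} {e} listed
      ; source  = insert-source {A} {e} source
      ; total≤m = ℕ.m+n≤o⇒m≤o _ room₁
      }

    acyclic₁ : ¬ Cycle (E₁ without e)
    acyclic₁ = acyclic ∘ cycle-mono
      (without-⊆ {E} {E₁} {e} λ e≢f → subst (_≡ true) (override-other Fin._≟_ E e≢f))

    rearrange : ∀ t r c l → 4 + (t + ((r + c) + suc (l + 1))) ≡ c + (((4 + (r + (t + 1))) + l) + 1)
    rearrange = solve-∀

    budget : 4 + (detectCost + (count E₁ * roundCost + suc k₀)) ≤
             count E * roundCost + (length (e ∷ es) * edgeCost + 1)
    budget = ℕ.≤-trans
      (ℕ.+-monoʳ-≤ 4 (ℕ.+-monoʳ-≤ detectCost (ℕ.+-monoˡ-≤ (suc k₀) (ℕ.*-monoˡ-≤ roundCost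
        (count-add {b = E} e λ f e≢f → subst (_≡ true) (override-other Fin._≟_ E e≢f))))))
      (ℕ.≤-reflexive (rearrange detectCost roundCost (count E * roundCost) (length es * edgeCost)))

  weightedCycleDeletion-runs : ∀ {σ} → Runs′ weightedCycleDeletion σ deletionCost λ _ _ → ⊤
  weightedCycleDeletion-runs {σ} =
    call (forAllFin-runs (λ σ′ → ∃ λ A → σ′ ≡ record σ { adjₛ = A }) (λ v σ′ → adjₛ σ′ v ≡ [])
           (λ { {v} (A , refl) → write-runs ((_ , refl) , override-same Fin._≟_ A v ,
             λ {u} eq → override-elim Fin._≟_ A v u (_≡ []) (λ _ → refl) λ _ → eq) })
           (_ , refl))
      λ { ((A , refl) , A≡[]) →
        call (forAllFin-runs (λ σ′ → ∃ λ E → σ′ ≡ record σ { adjₛ = A ; inGₛ = E }) (λ f σ′ → inGₛ σ′ f ≡ false)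
               (λ { {f} (E , refl) → write-runs ((_ , refl) , override-same Fin._≟_ E f ,
                 λ {g} eq → override-elim Fin._≟_ E f g (_≡ false) (λ _ → refl) λ _ → eq) })
               (_ , refl))
          λ { ((E , refl) , E≡false) →
            let absent : ∀ {f} → E f ≢ true
                absent {f} Ef = case trans (sym Ef) (E≡false f) of λ () in
            weaken (ℕ.≤-reflexive (cong₂ (λ c l → c * roundCost + (l * edgeCost + 1))
                     (total-zero λ f → cong (λ z → if z then 1 else 0) (E≡false f)) (length-tabulate {n = m} id)))
              (insertAll-runs edges (record
                { listed  = λ Ef → contradiction Ef absent
                ; source  = λ {v} {f} f∈ → case subst (f ∈_) (A≡[] v) f∈ of λ ()
                ; room    = ℕ.≤-reflexive (cong₂ _+_ (total-zero (cong length ∘ A≡[])) (length-tabulate {n = m} id))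
                ; acyclic = λ (f , Ef , _) → absent Ef
                })) } }

-- Logarithms and the final arithmetic

n<2^[1+log₂n] : ∀ n → n < 2 ^ suc ⌊log₂ n ⌋
n<2^[1+log₂n] n = go n (<-wellFounded n)
  where
  go : ∀ n → Acc _<_ n → n < 2 ^ suc ⌊log₂ n ⌋
  go 0 _ = s≤s z≤n
  go 1 _ = s≤s (s≤s z≤n)
  go n@(suc (suc k)) (acc smaller) = begin-strict
    n                                  ≡⟨ ℕ.⌊n/2⌋+⌈n/2⌉≡n n ⟨
    -- The ceiling exceeds the floor by at most one, and `suc h ≤ 2 ^ ⌊log₂ n ⌋` is the strict bound
    -- for `h` itself.
    h + ⌈ n /2⌉                        <⟨ ℕ.+-mono-<-≤ h<2^ (ℕ.≤-trans (ℕ.⌊n/2⌋-mono (ℕ.n≤1+n (suc n))) h<2^) ⟩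
    2 ^ ⌊log₂ n ⌋ + 2 ^ ⌊log₂ n ⌋      ≡⟨ cong (2 ^ ⌊log₂ n ⌋ +_) (ℕ.+-identityʳ _) ⟨
    2 ^ suc ⌊log₂ n ⌋                  ∎
    where
    open ℕ.≤-Reasoning
    h = ⌊ n /2⌋

    1+log₂h : suc ⌊log₂ h ⌋ ≡ ⌊log₂ n ⌋
    1+log₂h = trans (cong suc (⌊log₂⌊n/2⌋⌋≡⌊log₂n⌋∸1 n))
      (ℕ.m+[n∸m]≡n (⌊log₂⌋-mono-≤ {2} {n} (s≤s (s≤s z≤n))))

    h<2^ : h < 2 ^ ⌊log₂ n ⌋
    h<2^ = subst (λ l → h < 2 ^ l) 1+log₂h (go h (smaller (ℕ.⌊n/2⌋<n (suc k))))

-- With `suc m` and `suc d` in place of `m` and `D`, all differences have non-negative coefficients.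
-- The factors 86, 202 and 226 are the values of the respective bounding polynomials at
-- `n = m = d = 0`, where `X`, `Y` and `Z` equal 1; so the differences have no constant term.
module Bounds (V : OrderedAbelianGroup) {n m : ℕ} (G : WeightedMultidigraph V n (suc m))
  (d : ℕ) (n<2^D : n < 2 ^ suc d) where

  open PathSearch V G (suc d) n<2^D using (maxflowCost)
  open CycleCancellation V G (suc d) n<2^D using (deleteCost)
  open CycleDetection V G using (detectCost)
  open MainLoop V G (suc d) n<2^D using (deletionCost)

  private
    X Y Z : ℕ
    X = (suc m + n) * suc d
    Y = suc m * X
    Z = suc m * Y

    -- The bounds below are polynomial identities with an explicit non-negative difference.
    slack : ∀ {a b} s → a + s ≡ b → a ≤ b
    slack s eq = ℕ.m+n≤o⇒m≤o _ (ℕ.≤-reflexive eq)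

  maxflowCost-≤ : maxflowCost ≤ 86 * X
  maxflowCost-≤ = slack _ (identity n m d)
    where
    identity : ∀ n m d →
      ((n * 2 + 1) + (2 + ((4 + suc d * 9) + ((7 + (suc (suc d) * 15 + 1)) +
        suc (n * (5 + (7 + (suc (suc d) * 15 + 1))) + suc m * (9 + (5 + (4 + suc d * 9)))))))
        + (2 + ((n * 2 + 1) + 1)))
      + (53 * d + 59 * m + 77 * m * d + 39 * n + 71 * n * d)
      ≡ 86 * ((suc m + n) * suc d)
    identity = solve-∀

  deleteCost-≤ : deleteCost ≤ 202 * Y
  deleteCost-≤ = ℕ.≤-trans
    (ℕ.+-monoʳ-≤ (suc m * 2 + 1) (ℕ.+-monoˡ-≤ cancel
      (ℕ.*-monoʳ-≤ (suc (suc m)) (ℕ.+-monoˡ-≤ (suc n + ((suc m * 2 + 1) + 1)) maxflowCost-≤))))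
    (slack _ (identity n m d))
    where
    open CycleCancellation V G (suc d) n<2^D using () renaming (cancelCost to cancel)
    identity : ∀ n m d →
      ((suc m * 2 + 1) +
       (suc (suc m) * (86 * ((suc m + n) * suc d) + (suc n + ((suc m * 2 + 1) + 1))) +
        (((2 + n) + ((2 + n) + 1)) + ((suc m * ((2 + n) + ((2 + n) + 1)) + 1) + ((2 + n) + (suc n * 3 + 1))))))
      + (30 * d + 130 * m + 146 * m * d + 114 * m * m + 116 * m * m * d
         + 20 * n + 30 * n * d + 113 * n * m + 116 * n * m * d)
      ≡ 202 * (suc m * ((suc m + n) * suc d))
    identity = solve-∀

  deletionCost-≤ : deletionCost ≤ 226 * Z
  deletionCost-≤ = ℕ.≤-trans
    (ℕ.+-monoʳ-≤ (n * 1 + 1) (ℕ.+-monoʳ-≤ (suc m * 1 + 1) (ℕ.+-monoˡ-≤ 1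
      (ℕ.*-monoʳ-≤ (suc m) (ℕ.+-monoʳ-≤ 4 (ℕ.+-monoˡ-≤ (detectCost + 1)
        (ℕ.+-monoʳ-≤ detectCost (ℕ.+-monoˡ-≤ 1 deleteCost-≤))))))))
    (slack _ (identity n m d))
    where
    identity : ∀ n m d →
      ((n * 1 + 1) + ((suc m * 1 + 1) + (suc m *
        (4 + ((((n * 1 + 1) + (n * 4 + ((n * 2 + suc m * 5) + 1))) +
               (202 * (suc m * ((suc m + n) * suc d)) + 1)) +
              (((n * 1 + 1) + (n * 4 + ((n * 2 + suc m * 5) + 1))) + 1))) + 1)))
      + (24 * d + 41 * m + 72 * m * d + 62 * m * m + 72 * m * m * d + 24 * m * m * m
         + 24 * m * m * m * d + 9 * n + 24 * n * d + 34 * n * m + 48 * n * m * d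
         + 24 * n * m * m + 24 * n * m * m * d)
      ≡ 226 * (suc m * (suc m * ((suc m + n) * suc d)))
    identity = solve-∀

-- The endpoints of an edge differ. Hence `⌊log₂ n⌋` is at least 1, without which the additive 1 in
-- the heap depth could not be absorbed.
two-vertices : ∀ {V n m} → WeightedMultidigraph V n (suc m) → 2 ≤ n
two-vertices {n = 0}           G = case WeightedMultidigraph.src G zero of λ ()
two-vertices {n = 1}           G = contradiction (unique _ _) (WeightedMultidigraph.loopless G zero)
  where
  unique : (u v : Fin 1) → u ≡ v
  unique zero zero = refl
two-vertices {n = suc (suc n)} G = s≤s (s≤s z≤n)

theorem3p6 : ∃ λ (K : ℕ) →
    ∀ (V : OrderedAbelianGroup) {n m : ℕ} (G : WeightedMultidigraph V n m) → 1 ≤ m →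
    let open WeightedCycleDeletion V G in
    ∀ (σ : Store) → ∃₂ λ (σ′ : Store) (t : ℕ) →
    ⟨ weightedCycleDeletion , σ ⟩⇓⟨ tt , σ′ ⟩ t ×
    t ≤ K * ((m + n) * m ^ 2 * ⌊log₂ n ⌋)
-- 452 is twice 226, from `suc L ≤ L + L` for `L = ⌊log₂ n⌋`.
theorem3p6 = 452 , bounded
  where
  bounded : ∀ (V : OrderedAbelianGroup) {n m : ℕ} (G : WeightedMultidigraph V n m) → 1 ≤ m →
            let open WeightedCycleDeletion V G in
            ∀ (σ : Store) → ∃₂ λ (σ′ : Store) (t : ℕ) →
            ⟨ weightedCycleDeletion , σ ⟩⇓⟨ tt , σ′ ⟩ t ×
            t ≤ 452 * ((m + n) * m ^ 2 * ⌊log₂ n ⌋)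
  bounded V {n} {suc m} G _ σ = final , time , run , (begin
    time                                                ≤⟨ ℕ.m+n≤o⇒m≤o time within ⟩
    deletionCost                                        ≤⟨ deletionCost-≤ ⟩
    226 * (suc m * (suc m * ((suc m + n) * suc L)))     ≤⟨ ℕ.*-monoʳ-≤ 226 (ℕ.*-monoʳ-≤ (suc m) (ℕ.*-monoʳ-≤ (suc m)
                                                             (ℕ.*-monoʳ-≤ (suc m + n) (ℕ.+-monoˡ-≤ L 1≤L)))) ⟩
    226 * (suc m * (suc m * ((suc m + n) * (L + L))))   ≡⟨ collect n m L ⟩
    452 * ((suc m + n) * suc m ^ 2 * L)                 ∎)
    where
    open ℕ.≤-Reasoning
    L = ⌊log₂ n ⌋
    n<2^D = n<2^[1+log₂n] n
    open MainLoop V G (suc L) n<2^D using (deletionCost; weightedCycleDeletion-runs)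
    open Bounds V G L n<2^D using (deletionCost-≤)
    open ProgramLogic V G using (module Runs)
    open Runs (weightedCycleDeletion-runs {σ})

    1≤L : 1 ≤ L
    1≤L = ⌊log₂⌋-mono-≤ (two-vertices G)

    collect : ∀ n m l → 226 * (suc m * (suc m * ((suc m + n) * (l + l)))) ≡
                        452 * ((suc m + n) * (suc m * (suc m * 1)) * l)
    collect = solve-∀
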